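{- Let $n\ge1$. The map $$\Psi:\ \bigsqcup_{\lambda,\rho\in\mathbb S}\mathrm{SST}(\lambda/\rho,n)^2\longrightarrow\mathfrak F_{\mathrm{fin}}(\mathscr C_n',\mathbb N)\times\mathbb S,\qquad(P,Q)\mapsto(\mathbf c,\nu),$$ is a bijection, where, with $\boldsymbol\lambda=\boldsymbol\lambda[P,Q]$, $\mathbf c$ is the environment associated to $\boldsymbol\lambda$ and $\nu=(\nu_1,\dots,\nu_m)$ is given by $m=\max\{i:\lim_{t\to-\infty}\boldsymbol\lambda_i(t,0)\text{ exists and is finite}\}$ ($m=0$ and $\nu=\varnothing$ if there is no such $i$) and $\nu_i=\lim_{t\to-\infty}\boldsymbol\lambda_i(t,0)$ for $i=1,\dots,m$.
   Context: $\mathbb N=\{0,1,\dots\}$, $\mathbb Z'=\mathbb Z+\frac12$. A signature of length $\ell\ge0$ is a sequence of integers $\lambda=(\lambda_1\ge\dots\ge\lambda_\ell)$; $\mathbb S_\ell$ is the set of these, $\mathbb S=\bigsqcup_{\ell\ge0}\mathbb S_\ell$. Conjugate: $\lambda'_x=\#\{j:\lambda_j\ge x\}$, $x\in\mathbb Z$. $\kappa\preceq\mu$ (same length) means $\mu_1\ge\kappa_1\ge\mu_2\ge\kappa_2\ge\cdots$, equivalently $\mu'_x-\kappa'_x\in\{0,1\}$ for all $x$. For $\kappa\preceq\mu$, $\kappa\preceq\lambda$ in $\mathbb S_\ell$ put $a_x=\mu'_x-\kappa'_x$, $b_x=\lambda'_x-\kappa'_x$, and $c_x=\max\{0,a_x+b_x+c_{x-1}-1\}$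 with $c_x=0$ for $x$ sufficiently negative. $\overline{\mathsf F}(\kappa,\mu,\lambda)=\nu\in\mathbb S_\ell$ is given by $\nu'_x=\mu'_x+\lambda'_x-\kappa'_x+c_{x-1}-c_x$; the number $c_0$ (value at $x=0$) is the carrier load at the origin for $(\kappa,\mu,\lambda)$. $\mathscr C_n=\mathbb Z^2/\sim$ and $\mathscr C_n'=(\mathbb Z')^2/\sim$, where $(x,y)\sim(x+kn,y-kn)$, $k\in\mathbb Z$ ($\mathscr C'_n$ is the set of faces of $\mathscr C_n$). A Fomin field is a map $\boldsymbol\lambda:\mathscr C_n\to\mathbb S_\ell$ with $\boldsymbol\lambda(p)\preceq\boldsymbol\lambda(p+\mathbf e_i)$ ($i=1,2$) and $\boldsymbol\lambda(p+\mathbf e_1+\mathbf e_2)=\overline{\mathsf F}(\boldsymbol\lambda(p),\boldsymbol\lambda(p+\mathbf e_1),\boldsymbol\lambda(p+\mathbf e_2))$ for all $p$. Its environment is $\mathbf c:\mathscr C_n'\to\mathbb N$, where $\mathbf c(p+(\mathbf e_1+\mathbf e_2)/2)$ is the carrier load at the origin $c_0$ for $(\boldsymbol\lambda(p),\boldsymbol\lambda(p+\mathbf e_1),\boldsymbol\lambda(p+\mathbf e_2))$. $\mathfrak F_{\mathrm{fin}}(\mathscr C'_n,\mathbb N)$ is the set of finitely supported functions $\mathscr C_n'\to\mathbb N$. For $\rho,\lambda$ of the same length, $P\in\mathrm{SST}(\lambda/\rho,n)$ (semistandard tableau of skew shape) is a chain $\rho=\lambda^{(0)}\preceq\lambda^{(1)}\preceq\dots\preceq\lambda^{(n)}=\lambda$.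 For $P=(\lambda^{(i)})_i$, $Q=(\mu^{(i)})_i$ in $\mathrm{SST}(\lambda/\rho,n)$, $\boldsymbol\lambda[P,Q]$ is the unique Fomin field on $\mathscr C_n$ with $\boldsymbol\lambda(i,0)=\lambda^{(i)}$, $\boldsymbol\lambda(0,i)=\mu^{(i)}$, $0\le i\le n$. -}

module Defs where

open import Data.Fin.Base as Fin using (Fin; zero; suc; toℕ; inject₁; inject≤)
open import Data.Integer.Base as ℤ using (ℤ; +_; -[1+_]; 0ℤ; 1ℤ)
import Data.Integer.Properties as ℤ
open import Data.Nat.Base as ℕ using (ℕ; zero; suc; _∸_)
import Data.Nat.Properties as ℕ
open import Data.Product.Base using (Σ; ∃-syntax; _×_; _,_; proj₁; proj₂)
import Data.List.Membership.Setoid as Membership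
open import Data.Product.Relation.Binary.Pointwise.NonDependent using (_×ₛ_)
open import Data.Vec.Base as Vec using (Vec; []; _∷_; lookup; head; last)
open import Function.Base using (_∘_)
open import Function.Bundles using (Func; _⟨$⟩_)
import Function.Relation.Binary.Setoid.Equality as FuncEquality
open import Level using (0ℓ)
open import Relation.Binary.Bundles using (Setoid)
import Relation.Binary.Construct.On as On
open import Relation.Binary.PropositionalEquality
open import Relation.Nullary.Decidable.Core using (yes; no)
open import Relation.Nullary.Negation.Core using (¬_; contradiction)

-- Rows are indexed from 0.  Proofs of validity are irrelevant here and in
-- SST below, so that _≡_ compares only the combinatorial data.
record Signature (ℓ : ℕ) : Set where
  constructor mkSignature
  field
    parts   : Vec ℤ ℓ
    .sorted : ∀ i j → i Fin.≤ j → lookup parts j ℤ.≤ lookup parts i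

  part : Fin ℓ → ℤ
  part = lookup parts

open Signature public

𝕊 : Set
𝕊 = Σ ℕ Signature

conj : ∀ {ℓ} → Signature ℓ → ℤ → ℕ
conj ν x = Vec.count (x ℤ.≤?_) (parts ν)

infix 4 _⪯_

record _⪯_ {ℓ} (κ μ : Signature ℓ) : Set where
  field
    below : ∀ i → part κ i ℤ.≤ part μ i
    above : ∀ i j → toℕ j ≡ suc (toℕ i) → part μ j ℤ.≤ part κ i

-- A lower bound for all parts of κ.  For κ ⪯ μ and x ≤ bottom κ every row
-- of κ and of μ reaches column x, so μ′ₓ - κ′ₓ = 0 there.
bottom : ∀ {ℓ} → Signature ℓ → ℤ
bottom κ = Vec.foldr _ ℤ._⊓_ 0ℤ (parts κ)

-- μ′ₓ - κ′ₓ.  Truncated subtraction is exact when κ ⪯ μ.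
added : ∀ {ℓ} (κ μ : Signature ℓ) → ℤ → ℕ
added κ μ x = conj μ x ∸ conj κ x

-- sweep u s k is the load at s + k of a carrier which is empty at s and
-- satisfies cₓ = max {0, uₓ + cₓ₋₁ - 1} for x > s.
sweep : (ℤ → ℕ) → ℤ → ℕ → ℕ
sweep u s zero    = 0
sweep u s (suc k) = (u (s ℤ.+ + suc k) ℕ.+ sweep u s k) ∸ 1

positivePart : ℤ → ℕ
positivePart (+ k)    = k
positivePart -[1+ _ ] = 0

load : ∀ {ℓ} (κ μ ν : Signature ℓ) → ℤ → ℕ
load κ μ ν x =
  sweep (λ y → added κ μ y ℕ.+ added κ ν y) (bottom κ)
        (positivePart (x ℤ.- bottom κ))

-- ν is the value of the local rule at (κ , μ , λ); signatures are determined
-- by their conjugates.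
record IsF̄ {ℓ} (κ μ lam ν : Signature ℓ) : Set where
  field
    conj-eq : ∀ x →
      + conj ν x ≡ + conj μ x ℤ.+ + conj lam x ℤ.- + conj κ x
                   ℤ.+ + load κ μ lam (ℤ.pred x) ℤ.- + load κ μ lam x

-- load-vanishes and load-rec show that load is the sequence cₓ: it vanishes for
-- x sufficiently negative and satisfies the recursion at every x, so it does
-- not depend on the choice of starting column.

private
  positivePart-≤ : ∀ x s → x ℤ.≤ s → positivePart (x ℤ.- s) ≡ 0
  positivePart-≤ x s x≤s with x ℤ.- s | ℤ.i≤j⇒i-j≤0 x≤s
  ... | + zero   | _ = refl
  ... | -[1+ _ ] | _ = refl
  ... | + suc _  | ℤ.+≤+ ()

  bottom-≤ : ∀ {ℓ} (xs : Vec ℤ ℓ) i → Vec.foldr _ ℤ._⊓_ 0ℤ xs ℤ.≤ lookup xs i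
  bottom-≤ (x ∷ xs) zero    = ℤ.i⊓j≤i x _
  bottom-≤ (x ∷ xs) (suc i) = ℤ.≤-trans (ℤ.i⊓j≤j x _) (bottom-≤ xs i)

  count-all : ∀ {ℓ} x (xs : Vec ℤ ℓ) → (∀ i → x ℤ.≤ lookup xs i) →
              Vec.count (x ℤ.≤?_) xs ≡ ℓ
  count-all x []       h = refl
  count-all x (y ∷ ys) h with x ℤ.≤? y
  ... | yes _  = cong suc (count-all x ys (h ∘ suc))
  ... | no x≰y = contradiction (h zero) x≰y

  added-≤ : ∀ {ℓ} {κ μ : Signature ℓ} → κ ⪯ μ →
            ∀ x → x ℤ.≤ bottom κ → added κ μ x ≡ 0
  added-≤ {ℓ} {κ} {μ} κ⪯μ x x≤b = begin
    conj μ x ∸ conj κ x  ≡⟨ cong₂ _∸_ (count-all x (parts μ) x≤μ) (count-all x (parts κ) x≤κ) ⟩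
    ℓ ∸ ℓ                ≡⟨ ℕ.n∸n≡0 ℓ ⟩
    0                    ∎
    where
    open ≡-Reasoning
    x≤κ : ∀ i → x ℤ.≤ part κ i
    x≤κ i = ℤ.≤-trans x≤b (bottom-≤ (parts κ) i)
    x≤μ : ∀ i → x ℤ.≤ part μ i
    x≤μ i = ℤ.≤-trans (x≤κ i) (_⪯_.below κ⪯μ i)

  s+[x-s]≡x : ∀ x s → s ℤ.+ (x ℤ.- s) ≡ x
  s+[x-s]≡x x s = begin
    s ℤ.+ (x ℤ.+ ℤ.- s)  ≡⟨ ℤ.+-comm s _ ⟩
    x ℤ.+ ℤ.- s ℤ.+ s    ≡⟨ ℤ.+-assoc x (ℤ.- s) s ⟩
    x ℤ.+ (ℤ.- s ℤ.+ s)  ≡⟨ cong (λ y → x ℤ.+ y) (ℤ.+-inverseˡ s) ⟩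
    x ℤ.+ 0ℤ             ≡⟨ ℤ.+-identityʳ x ⟩
    x                    ∎
    where open ≡-Reasoning

  sweep-rec : ∀ u s x d → x ≡ s ℤ.+ d → ¬ d ℤ.≤ 0ℤ →
              sweep u s (positivePart d) ≡
              (u x ℕ.+ sweep u s (positivePart (ℤ.pred d))) ∸ 1
  sweep-rec u s _ (+ suc k) refl d≰0 = refl
  sweep-rec u s _ (+ zero)  _    d≰0 = contradiction ℤ.≤-refl d≰0
  sweep-rec u s _ -[1+ k ]  _    d≰0 = contradiction ℤ.-≤+ d≰0

load-vanishes : ∀ {ℓ} (κ μ ν : Signature ℓ) x → x ℤ.≤ bottom κ →
                load κ μ ν x ≡ 0
load-vanishes κ μ ν x x≤b =
  cong (sweep (λ y → added κ μ y ℕ.+ added κ ν y) (bottom κ))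
       (positivePart-≤ x (bottom κ) x≤b)

load-rec : ∀ {ℓ} {κ μ ν : Signature ℓ} → κ ⪯ μ → κ ⪯ ν → ∀ x →
           load κ μ ν x ≡
           ((added κ μ x ℕ.+ added κ ν x) ℕ.+ load κ μ ν (ℤ.pred x)) ∸ 1
load-rec {ℓ} {κ} {μ} {ν} κ⪯μ κ⪯ν x with x ℤ.≤? bottom κ
... | yes x≤b
  rewrite load-vanishes κ μ ν x x≤b
        | load-vanishes κ μ ν (ℤ.pred x) (ℤ.i≤j⇒pred[i]≤j x≤b)
        | added-≤ κ⪯μ x x≤b | added-≤ κ⪯ν x x≤b = refl
... | no x≰b
  rewrite ℤ.pred-+ x (ℤ.- bottom κ) =
  sweep-rec _ (bottom κ) x (x ℤ.- bottom κ) (sym (s+[x-s]≡x x (bottom κ)))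
            (x≰b ∘ ℤ.i-j≤0⇒i≤j)

Point : Set
Point = ℤ × ℤ

infixl 6 _+e₁ _+e₂

_+e₁ _+e₂ : Point → Point
(x , y) +e₁ = ℤ.suc x , y
(x , y) +e₂ = x , ℤ.suc y

shift : ℕ → ℤ → Point → Point
shift n k (x , y) = x ℤ.+ k ℤ.* + n , y ℤ.- k ℤ.* + n

_≈[_]_ : Point → ℕ → Point → Set
p ≈[ n ] q = ∃[ k ] q ≡ shift n k p

private
  shift-zero : ∀ n p → p ≡ shift n 0ℤ p
  shift-zero n (x , y) =
    cong₂ _,_ (sym (ℤ.+-identityʳ x)) (sym (ℤ.+-identityʳ y))

  shift-shift : ∀ n j k p → shift n k (shift n j p) ≡ shift n (j ℤ.+ k) p
  shift-shift n j k (x , y) = cong₂ _,_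
    (trans (ℤ.+-assoc x (j ℤ.* + n) (k ℤ.* + n))
           (cong (λ z → x ℤ.+ z) (sym (ℤ.*-distribʳ-+ (+ n) j k))))
    (trans (ℤ.+-assoc y (ℤ.- (j ℤ.* + n)) (ℤ.- (k ℤ.* + n)))
           (cong (λ z → y ℤ.+ z)
             (trans (sym (ℤ.neg-distrib-+ (j ℤ.* + n) (k ℤ.* + n)))
                    (cong ℤ.-_ (sym (ℤ.*-distribʳ-+ (+ n) j k))))))

  shift-+e₁ : ∀ n k p → shift n k p +e₁ ≡ shift n k (p +e₁)
  shift-+e₁ n k (x , y) = cong (_, _) (sym (ℤ.+-assoc 1ℤ x (k ℤ.* + n)))

  shift-+e₂ : ∀ n k p → shift n k p +e₂ ≡ shift n k (p +e₂)
  shift-+e₂ n k (x , y) = cong (_ ,_) (sym (ℤ.+-assoc 1ℤ y (ℤ.- (k ℤ.* + n))))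

𝒞 : ℕ → Setoid 0ℓ 0ℓ
𝒞 n = record
  { Carrier = Point
  ; _≈_     = λ p q → p ≈[ n ] q
  ; isEquivalence = record
    { refl  = λ {p} → 0ℤ , shift-zero n p
    ; sym   = λ { {p} (k , refl) → ℤ.- k ,
        sym (trans (shift-shift n k (ℤ.- k) p)
                   (trans (cong (λ j → shift n j p) (ℤ.+-inverseʳ k))
                          (sym (shift-zero n p)))) }
    ; trans = λ { {p} (j , refl) (k , refl) → j ℤ.+ k , shift-shift n j k p }
    }
  }

-- The face with centre p + (e₁ + e₂)/2 is represented by its corner p ∈ ℤ²;
-- translation by (kn , -kn) acts on the two in the same way.
𝒞′ : ℕ → Setoid 0ℓ 0ℓ
𝒞′ = 𝒞

FaceMap : ℕ → Set
FaceMap n = Func (𝒞′ n) (setoid ℕ)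

FinitelySupported : ∀ {n} → FaceMap n → Set
FinitelySupported {n} c = ∃[ ps ] ∀ p → c ⟨$⟩ p ≢ 0 → p ∈ ps
  where open Membership (𝒞′ n)

𝔉-fin : ℕ → Setoid 0ℓ 0ℓ
𝔉-fin n = On.setoid {B = Σ (FaceMap n) (FinitelySupported {n})}
                    (FuncEquality.setoid (𝒞′ n) (setoid ℕ)) proj₁

record FominField (n ℓ : ℕ) : Set where
  field
    field-map : Func (𝒞 n) (setoid (Signature ℓ))

  at : Point → Signature ℓ
  at p = field-map ⟨$⟩ p

  field
    interlace₁ : ∀ p → at p ⪯ at (p +e₁)
    interlace₂ : ∀ p → at p ⪯ at (p +e₂)
    local-rule : ∀ p → IsF̄ (at p) (at (p +e₁)) (at (p +e₂)) (at (p +e₁ +e₂))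

open FominField public using (at)

environment : ∀ {n ℓ} → FominField n ℓ → FaceMap n
environment {n} {ℓ} Λ = record
  { to   = λ p → load (at Λ p) (at Λ (p +e₁)) (at Λ (p +e₂)) 0ℤ
  ; cong = λ { {p} {q} (k , eq) → load-cong
      (Func.cong Λ.field-map {p} {q} (k , eq))
      (Func.cong Λ.field-map {p +e₁} {q +e₁}
        (k , trans (cong _+e₁ eq) (shift-+e₁ n k p)))
      (Func.cong Λ.field-map {p +e₂} {q +e₂}
        (k , trans (cong _+e₂ eq) (shift-+e₂ n k p))) }
  }
  where
  module Λ = FominField Λ
  load-cong : ∀ {κ κ′ μ μ′ ν ν′ : Signature ℓ} → κ ≡ κ′ → μ ≡ μ′ → ν ≡ ν′ →
              load κ μ ν 0ℤ ≡ load κ′ μ′ ν′ 0ℤ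
  load-cong refl refl refl = refl

record SST {ℓ} (outer inner : Signature ℓ) (n : ℕ) : Set where
  constructor mkSST
  field
    chain   : Vec (Signature ℓ) (suc n)
    .first  : head chain ≡ inner
    .final  : last chain ≡ outer
    .strips : ∀ (i : Fin n) → lookup chain (inject₁ i) ⪯ lookup chain (suc i)

open SST public using (chain)

-- The disjoint union of SST(λ/ρ, n)² over all pairs of signatures λ, ρ of the
-- same length; SST(λ/ρ, n) exists only for such pairs.
record TableauPair (n : ℕ) : Set where
  constructor mkTableauPair
  field
    {len}       : ℕ
    outer inner : Signature len
    P Q         : SST outer inner n

record HasBoundary {n} (PQ : TableauPair n)
                   (Λ : FominField n (TableauPair.len PQ)) : Set where
  open TableauPair PQ
  field
    on-axis₁ : ∀ (i : Fin (suc n)) → at Λ (+ toℕ i , 0ℤ) ≡ lookup (chain P) i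
    on-axis₂ : ∀ (i : Fin (suc n)) → at Λ (0ℤ , + toℕ i) ≡ lookup (chain Q) i

-- Λ is 𝛌[P,Q], the unique Fomin field with boundary (P , Q).
record Is𝛌[P,Q] {n} (PQ : TableauPair n)
                (Λ : FominField n (TableauPair.len PQ)) : Set where
  field
    boundary : HasBoundary PQ Λ
    unique   : ∀ Λ′ → HasBoundary PQ Λ′ → ∀ p → at Λ′ p ≡ at Λ p

-- Convergence as t → -∞ of an integer-valued function.  In the discrete
-- space ℤ (a closed subset of ℝ) this means being eventually constant, and a
-- finite limit is necessarily an integer.
_⟶_ : (ℤ → ℤ) → ℤ → Set
f ⟶ L = ∃[ T ] ∀ t → t ℤ.≤ T → f t ≡ L

row : ∀ {n ℓ} → FominField n ℓ → Fin ℓ → ℤ → ℤ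
row Λ i t = part (at Λ (t , 0ℤ)) i

-- With rows indexed from 0, m is the largest 1-based index of a row having
-- a finite limit, or 0 if there is none: row m - 1 converges by `limits`, and
-- the rows from m on do not converge by `maximal`.
record IsLimit {n ℓ} (Λ : FominField n ℓ) (mν : 𝕊) : Set where
  m : ℕ
  m = proj₁ mν

  ν : Signature m
  ν = proj₂ mν

  field
    m≤ℓ     : m ℕ.≤ ℓ
    limits  : ∀ (i : Fin m) → row Λ (inject≤ i m≤ℓ) ⟶ part ν i
    maximal : ∀ (i : Fin ℓ) → m ℕ.≤ toℕ i → ¬ (∃[ L ] row Λ i ⟶ L)

Source : ℕ → Setoid 0ℓ 0ℓ
Source n = setoid (TableauPair n)

Target : ℕ → Setoid 0ℓ 0ℓ
Target n = 𝔉-fin n ×ₛ setoid 𝕊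

-- The value of Ψ at (P , Q): it exists only if the environment of 𝛌[P,Q] is
-- finitely supported, and it is unique up to the equality of Target n.
record IsΨ {n} (PQ : TableauPair n) (cν : Setoid.Carrier (Target n)) : Set where
  c : FaceMap n
  c = proj₁ (proj₁ cν)

  ν : 𝕊
  ν = proj₂ cν

  field
    𝛌      : FominField n (TableauPair.len PQ)
    is-𝛌   : Is𝛌[P,Q] PQ 𝛌
    env    : ∀ p → environment 𝛌 ⟨$⟩ p ≡ c ⟨$⟩ p
    limit  : IsLimit 𝛌 ν

{-# OPTIONS --safe #-}

-- Fix a column x and look at the column lengths λ′ₓ(p) for all p at once.  At
-- a face the local rule takes the load cₓ₋₁ to cₓ and, up to the reflection
-- p ↦ -p, λ′ ↦ -λ′, which exchanges cₓ₋₁ and cₓ, it is its own inverse.  If no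
-- load enters, the new length is the maximum of the two adjacent ones, so by
-- periodicity the lengths become constant after time n (time being x + y).
-- Hence a finitely supported cₓ₋₁ and a constant value of λ′ₓ in the past
-- determine λ′ₓ, and cₓ is again finitely supported; likewise backwards.
--
-- The total increase of λ′ₓ from past to future does not depend on x, by
-- comparing adjacent columns in both directions.  So the values of λ′ₓ in the
-- past are the conjugate of a signature ν of length ℓ - height, and (c₀ , ν)
-- determines the field.  Conversely, starting from c₀ one obtains all columns;
-- at a given point a pulse loses a unit of load with every column once those
-- before it have passed, so λ′ₓ(p) is zero for large x and ℓ for small x.
--
-- The field with boundary (P , Q) is built from n × n squares, each filled by
-- the local rule; the top and right sides of a square are the bottom and left
-- sides of the next one on the cylinder.
module Submission where

open import Defs
open import Algebra.Bundles using (AbelianGroup)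
import Algebra.Properties.Group
open import Data.Empty using (⊥-elim)
open import Data.Fin.Base as Fin using (Fin; zero; suc; toℕ; fromℕ<; inject₁; inject≤)
import Data.Fin.Properties as Fin
open import Data.Integer.Base as ℤ using (ℤ; +_; -[1+_]; 0ℤ; 1ℤ; -1ℤ)
import Data.Integer.DivMod as ℤ
import Data.Integer.Properties as ℤ
open import Data.Integer.Tactic.RingSolver using (solve-∀)
open import Data.List.Base as List using (List; []; _∷_; upTo; cartesianProduct)
open import Data.List.Membership.Propositional.Properties using (∈-cartesianProduct⁺; ∈-upTo⁺; ∈-map⁺)
open import Data.List.Relation.Unary.Any as Any using (Any; here; there)
open import Data.Nat.Base as ℕ using (ℕ; zero; suc; _∸_; z≤n; s≤s; _≤_)
import Data.Nat.Properties as ℕ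
open import Data.Product.Base using (Σ-syntax; ∃-syntax; _×_; _,_; proj₁; proj₂)
open import Data.Sum.Base using (_⊎_; inj₁; inj₂)
open import Data.Vec.Base as Vec using (Vec; []; _∷_; lookup; tabulate; head; last)
import Data.Vec.Properties as Vec
open import Function.Base using (_∘_)
open import Function.Bundles using (Func; _⟨$⟩_; Bijection)
open import Relation.Binary.Definitions using (tri<; tri≈; tri>)
open import Relation.Binary.PropositionalEquality
open import Relation.Nullary.Decidable.Core using (Dec; yes; no; recompute; map′)
open import Relation.Nullary.Negation.Core using (¬_; contradiction)

-- Induction over ℤ and over the lattice

-- Only the load between columns 0 and 1 is recorded, so every argument has to run in both
-- directions of x. This is why the rule at a face is a relation (`Plaq`) rather than a function,
-- and why lengths are integers: negating them exchanges entering and leaving load, and a statement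
-- about the past, or about columns further left, becomes the reflection of one about the future, or
-- about columns further right. One inequality, `plaq-compare`, carries the structure across
-- columns. It holds because adjacent columns share a load, and it serves three times: the lengths
-- produced by the local rule form a conjugate, the height of a column is conserved, and the columns
-- built from an environment fit together into signatures. For a given field finite support is not
-- an assumption. It starts from the columns far to the right, empty in the past, and those far to
-- the left, full in the future, and passes from column to column by exchanging constancy of lengths
-- for vanishing of loads.

≤+∣-∣ : ∀ x s → x ℤ.≤ s ℤ.+ + ℤ.∣ x ℤ.- s ∣
≤+∣-∣ x s = subst (ℤ._≤ s ℤ.+ + ℤ.∣ x ℤ.- s ∣) (eq x s) (ℤ.+-monoʳ-≤ s (i≤∣i∣ (x ℤ.- s)))
  where
  eq : ∀ x s → s ℤ.+ (x ℤ.- s) ≡ x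
  eq = solve-∀
  i≤∣i∣ : ∀ i → i ℤ.≤ + ℤ.∣ i ∣
  i≤∣i∣ (+ n)    = ℤ.≤-refl
  i≤∣i∣ -[1+ n ] = ℤ.-≤+

suc≤⇒≤pred : ∀ {x y} → ℤ.suc x ℤ.≤ y → x ℤ.≤ ℤ.pred y
suc≤⇒≤pred {x} h = subst (ℤ._≤ _) (ℤ.pred-suc x) (ℤ.pred-mono h)

≤suc⇒pred≤ : ∀ {x y} → x ℤ.≤ ℤ.suc y → ℤ.pred x ℤ.≤ y
≤suc⇒pred≤ {y = y} h = subst (_ ℤ.≤_) (ℤ.pred-suc y) (ℤ.pred-mono h)

≰⇒suc≤ : ∀ {x y} → ¬ x ℤ.≤ y → ℤ.suc y ℤ.≤ x
≰⇒suc≤ h = ℤ.i<j⇒suc[i]≤j (ℤ.≰⇒> h)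

suc≰ : ∀ {x} → ¬ ℤ.suc x ℤ.≤ x
suc≰ h = ℤ.<-irrefl refl (ℤ.suc[i]≤j⇒i<j h)

≤-suc : ∀ {x y} → x ℤ.≤ y → x ℤ.≤ ℤ.suc y
≤-suc = ℤ.i≤j⇒i≤1+j

suc-injective : ∀ {x y} → ℤ.suc x ≡ ℤ.suc y → x ≡ y
suc-injective {x} {y} e = trans (sym (ℤ.pred-suc x)) (trans (cong ℤ.pred e) (ℤ.pred-suc y))

-- The recursion is on the bound `∣ x - s ∣`. As `step` is available at every x, descending below
-- `s` does no harm and no case distinction is needed.
ℤ-ascend : (Q : ℤ → Set) (s : ℤ) → (∀ x → x ℤ.≤ s → Q x) →
           (∀ x → Q (ℤ.pred x) → Q x) → ∀ x → Q x
ℤ-ascend Q s base step x = go _ x (≤+∣-∣ x s)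
  where
  go : ∀ k x → x ℤ.≤ s ℤ.+ + k → Q x
  go zero    x h = base x (subst (x ℤ.≤_) (ℤ.+-identityʳ s) h)
  go (suc k) x h = step x (go k (ℤ.pred x) (≤suc⇒pred≤ (subst (x ℤ.≤_) (eq s (+ k)) h)))
    where
    eq : ∀ s k → s ℤ.+ (1ℤ ℤ.+ k) ≡ 1ℤ ℤ.+ (s ℤ.+ k)
    eq = solve-∀

ℤ-descend : (Q : ℤ → Set) (s : ℤ) → (∀ x → s ℤ.≤ x → Q x) →
            (∀ x → Q x → Q (ℤ.pred x)) → ∀ x → Q x
ℤ-descend Q s base step x = subst Q (ℤ.neg-involutive x)
  (ℤ-ascend (λ y → Q (ℤ.- y)) (ℤ.- s)
    (λ y y≤ → base (ℤ.- y) (subst (ℤ._≤ ℤ.- y) (ℤ.neg-involutive s) (ℤ.neg-mono-≤ y≤)))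
    (λ y q → subst Q (eq y) (step (ℤ.- (ℤ.pred y)) q))
    (ℤ.- x))
  where
  eq : ∀ y → -1ℤ ℤ.+ (ℤ.- (-1ℤ ℤ.+ y)) ≡ ℤ.- y
  eq = solve-∀

ℤ-bidirectional : (Q : ℤ → Set) → Q 0ℤ → (∀ x → Q (ℤ.pred x) → Q x) →
                  (∀ x → Q x → Q (ℤ.pred x)) → ∀ x → Q x
ℤ-bidirectional Q q₀ up down (+ zero)       = q₀
ℤ-bidirectional Q q₀ up down (+ suc k)      = up (+ suc k) (ℤ-bidirectional Q q₀ up down (+ k))
ℤ-bidirectional Q q₀ up down -[1+ zero ]    = down 0ℤ q₀
ℤ-bidirectional Q q₀ up down -[1+ suc k ]   = down -[1+ k ] (ℤ-bidirectional Q q₀ up down -[1+ k ])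

time : Point → ℤ
time (x , y) = x ℤ.+ y

time-+e₁ : ∀ p → time (p +e₁) ≡ ℤ.suc (time p)
time-+e₁ (x , y) = ℤ.+-assoc 1ℤ x y

time-+e₂ : ∀ p → time (p +e₂) ≡ ℤ.suc (time p)
time-+e₂ (x , y) = eq x y
  where
  eq : ∀ x y → x ℤ.+ (1ℤ ℤ.+ y) ≡ 1ℤ ℤ.+ (x ℤ.+ y)
  eq = solve-∀

time-+e₁+e₂ : ∀ p → time (p +e₁ +e₂) ≡ ℤ.suc (ℤ.suc (time p))
time-+e₁+e₂ p = trans (time-+e₂ (p +e₁)) (cong ℤ.suc (time-+e₁ p))

time-≤-+e₁ : ∀ p → time p ℤ.≤ time (p +e₁)
time-≤-+e₁ p = subst (time p ℤ.≤_) (sym (time-+e₁ p)) (ℤ.i≤suc[i] _)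

time-≤-+e₂ : ∀ p → time p ℤ.≤ time (p +e₂)
time-≤-+e₂ p = subst (time p ℤ.≤_) (sym (time-+e₂ p)) (ℤ.i≤suc[i] _)

time-≤-+e₁+e₂ : ∀ p → time p ℤ.≤ time (p +e₁ +e₂)
time-≤-+e₁+e₂ p = ℤ.≤-trans (time-≤-+e₁ p) (time-≤-+e₂ (p +e₁))

_-e₁-e₂ : Point → Point
(x , y) -e₁-e₂ = ℤ.pred x , ℤ.pred y

-e₁-e₂+e₁+e₂ : ∀ p → p -e₁-e₂ +e₁ +e₂ ≡ p
-e₁-e₂+e₁+e₂ (x , y) = cong₂ _,_ (ℤ.suc-pred x) (ℤ.suc-pred y)

-- Each lattice point is the last corner of one face, whose other three corners have smaller time.
past-induction : (Q : Point → Set) (s : ℤ) → (∀ p → time p ℤ.≤ s → Q p) →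
                 (∀ q → Q q → Q (q +e₁) → Q (q +e₂) → Q (q +e₁ +e₂)) → ∀ p → Q p
past-induction Q s base step p = go _ p (≤+∣-∣ (time p) s)
  where
  eq : ∀ s k → s ℤ.+ (1ℤ ℤ.+ k) ≡ 1ℤ ℤ.+ (s ℤ.+ k)
  eq = solve-∀
  go : ∀ k p → time p ℤ.≤ s ℤ.+ + k → Q p
  go zero    p h = base p (subst (time p ℤ.≤_) (ℤ.+-identityʳ s) h)
  go (suc k) p h = subst Q (-e₁-e₂+e₁+e₂ p)
    (step q (go k q (ℤ.≤-trans (time-≤-+e₁ q) q₁≤)) (go k (q +e₁) q₁≤)
            (go k (q +e₂) (subst (ℤ._≤ _) (trans (time-+e₁ q) (sym (time-+e₂ q))) q₁≤)))
    where
    q : Point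
    q = p -e₁-e₂
    q₁≤ : time (q +e₁) ℤ.≤ s ℤ.+ + k
    q₁≤ = subst (ℤ._≤ s ℤ.+ + k) (ℤ.pred-suc (time (q +e₁)))
            (subst (λ z → ℤ.pred z ℤ.≤ _)
                   (trans (cong time (sym (-e₁-e₂+e₁+e₂ p))) (time-+e₂ (q +e₁)))
                   (≤suc⇒pred≤ (subst (time p ℤ.≤_) (eq s (+ k)) h)))

-- Plaq c l l₁ l₂ l₁₂ c′ is the rule in one column at one face: l, l₁, l₂, l₁₂
-- are the column lengths at p, p + e₁, p + e₂, p + e₁ + e₂, and the carrier
-- enters the column with load c and leaves it with load c′.
data Plaq : ℕ → ℤ → ℤ → ℤ → ℤ → ℕ → Set where
  idle  : ∀ {l} → Plaq 0 l l l l 0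
  drop  : ∀ {k l} → Plaq (suc k) l l l (ℤ.suc l) k
  pass₁ : ∀ {k l} → Plaq k l (ℤ.suc l) l (ℤ.suc l) k
  pass₂ : ∀ {k l} → Plaq k l l (ℤ.suc l) (ℤ.suc l) k
  take  : ∀ {k l} → Plaq k l (ℤ.suc l) (ℤ.suc l) (ℤ.suc l) (suc k)

plaq-l≤l₁ : ∀ {c l l₁ l₂ l₁₂ c′} → Plaq c l l₁ l₂ l₁₂ c′ → l ℤ.≤ l₁
plaq-l≤l₁ idle  = ℤ.≤-refl
plaq-l≤l₁ drop  = ℤ.≤-refl
plaq-l≤l₁ pass₁ = ℤ.i≤suc[i] _
plaq-l≤l₁ pass₂ = ℤ.≤-refl
plaq-l≤l₁ take  = ℤ.i≤suc[i] _

plaq-l₁≤l₁₂ : ∀ {c l l₁ l₂ l₁₂ c′} → Plaq c l l₁ l₂ l₁₂ c′ → l₁ ℤ.≤ l₁₂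
plaq-l₁≤l₁₂ idle  = ℤ.≤-refl
plaq-l₁≤l₁₂ drop  = ℤ.i≤suc[i] _
plaq-l₁≤l₁₂ pass₁ = ℤ.≤-refl
plaq-l₁≤l₁₂ pass₂ = ℤ.i≤suc[i] _
plaq-l₁≤l₁₂ take  = ℤ.≤-refl

plaq-swap : ∀ {c l l₁ l₂ l₁₂ c′} → Plaq c l l₁ l₂ l₁₂ c′ → Plaq c l l₂ l₁ l₁₂ c′
plaq-swap idle  = idle
plaq-swap drop  = drop
plaq-swap pass₁ = pass₂
plaq-swap pass₂ = pass₁
plaq-swap take  = take

plaq-l≤l₂ : ∀ {c l l₁ l₂ l₁₂ c′} → Plaq c l l₁ l₂ l₁₂ c′ → l ℤ.≤ l₂
plaq-l≤l₂ P = plaq-l≤l₁ (plaq-swap P)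

plaq-l₂≤l₁₂ : ∀ {c l l₁ l₂ l₁₂ c′} → Plaq c l l₁ l₂ l₁₂ c′ → l₂ ℤ.≤ l₁₂
plaq-l₂≤l₁₂ P = plaq-l₁≤l₁₂ (plaq-swap P)

plaq-l₁₂≤suc-l : ∀ {c l l₁ l₂ l₁₂ c′} → Plaq c l l₁ l₂ l₁₂ c′ → l₁₂ ℤ.≤ ℤ.suc l
plaq-l₁₂≤suc-l idle  = ℤ.i≤suc[i] _
plaq-l₁₂≤suc-l drop  = ℤ.≤-refl
plaq-l₁₂≤suc-l pass₁ = ℤ.≤-refl
plaq-l₁₂≤suc-l pass₂ = ℤ.≤-refl
plaq-l₁₂≤suc-l take  = ℤ.≤-refl

plaq-idle : ∀ {c l l₁ l₂ l₁₂ c′} → Plaq c l l₁ l₂ l₁₂ c′ → l₁₂ ℤ.≤ l → c ≡ 0 × c′ ≡ 0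
plaq-idle idle  h = refl , refl
plaq-idle drop  h = ⊥-elim (suc≰ h)
plaq-idle pass₁ h = ⊥-elim (suc≰ h)
plaq-idle pass₂ h = ⊥-elim (suc≰ h)
plaq-idle take  h = ⊥-elim (suc≰ h)

plaq-empty : ∀ {c l l₁ l₂ l₁₂ c′} → Plaq c l l₁ l₂ l₁₂ c′ → c ≡ 0 → l₁₂ ≡ l₁ ⊎ l₁₂ ≡ l₂
plaq-empty idle  h = inj₁ refl
plaq-empty pass₁ h = inj₁ refl
plaq-empty pass₂ h = inj₂ refl
plaq-empty take  h = inj₁ refl

plaq-flat : ∀ {c l l₁ l₂ l₁₂ c′} → Plaq c l l₁ l₂ l₁₂ c′ → l₁ ≡ l → l₂ ≡ l →
            c′ ≡ c ∸ 1 × (c ≡ 0 → l₁₂ ≡ l)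
plaq-flat idle  e₁ e₂ = refl , λ _ → refl
plaq-flat drop  e₁ e₂ = refl , λ ()
plaq-flat pass₁ e₁ e₂ = ⊥-elim (ℤ.i≢suc[i] (sym e₁))
plaq-flat pass₂ e₁ e₂ = ⊥-elim (ℤ.i≢suc[i] (sym e₂))
plaq-flat take  e₁ e₂ = ⊥-elim (ℤ.i≢suc[i] (sym e₁))

plaq-balance : ∀ {c l l₁ l₂ l₁₂ c′} → Plaq c l l₁ l₂ l₁₂ c′ →
               l₁₂ ≡ l₁ ℤ.+ l₂ ℤ.- l ℤ.+ + c ℤ.- + c′
plaq-balance (idle {l}) = eq l
  where eq : ∀ l → l ≡ l ℤ.+ l ℤ.- l ℤ.+ 0ℤ ℤ.- 0ℤ
        eq = solve-∀
plaq-balance (drop {k} {l}) = eq (+ k) l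
  where eq : ∀ k l → 1ℤ ℤ.+ l ≡ l ℤ.+ l ℤ.- l ℤ.+ (1ℤ ℤ.+ k) ℤ.- k
        eq = solve-∀
plaq-balance (pass₁ {k} {l}) = eq (+ k) l
  where eq : ∀ k l → 1ℤ ℤ.+ l ≡ (1ℤ ℤ.+ l) ℤ.+ l ℤ.- l ℤ.+ k ℤ.- k
        eq = solve-∀
plaq-balance (pass₂ {k} {l}) = eq (+ k) l
  where eq : ∀ k l → 1ℤ ℤ.+ l ≡ l ℤ.+ (1ℤ ℤ.+ l) ℤ.- l ℤ.+ k ℤ.- k
        eq = solve-∀
plaq-balance (take {k} {l}) = eq (+ k) l
  where eq : ∀ k l → 1ℤ ℤ.+ l ≡ (1ℤ ℤ.+ l) ℤ.+ (1ℤ ℤ.+ l) ℤ.- l ℤ.+ k ℤ.- (1ℤ ℤ.+ k)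
        eq = solve-∀

-- Only differences of lengths enter the rule. This allows columns to be normalised to start from 0,
-- and the conjugate of the limit to be added at the end.
plaq-shift : ∀ {c l l₁ l₂ l₁₂ c′} d → Plaq c l l₁ l₂ l₁₂ c′ →
             Plaq c (l ℤ.+ d) (l₁ ℤ.+ d) (l₂ ℤ.+ d) (l₁₂ ℤ.+ d) c′
plaq-shift d idle                                       = idle
plaq-shift d (drop  {l = l}) rewrite ℤ.+-assoc 1ℤ l d = drop
plaq-shift d (pass₁ {l = l}) rewrite ℤ.+-assoc 1ℤ l d = pass₁
plaq-shift d (pass₂ {l = l}) rewrite ℤ.+-assoc 1ℤ l d = pass₂
plaq-shift d (take  {l = l}) rewrite ℤ.+-assoc 1ℤ l d = take

-- A half turn of the face exchanges `take` and `drop`. It also swaps the corners p + e₁ and p + e₂,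
-- so `pass₁` and `pass₂` stay what they are.
plaq-reflect : ∀ {c l l₁ l₂ l₁₂ c′} → Plaq c l l₁ l₂ l₁₂ c′ →
               Plaq c′ (ℤ.- l₁₂) (ℤ.- l₂) (ℤ.- l₁) (ℤ.- l) c
plaq-reflect = go
  where
  eq : ∀ l → ℤ.- l ≡ 1ℤ ℤ.+ (ℤ.- (1ℤ ℤ.+ l))
  eq = solve-∀
  go : ∀ {c l l₁ l₂ l₁₂ c′} → Plaq c l l₁ l₂ l₁₂ c′ →
       Plaq c′ (ℤ.- l₁₂) (ℤ.- l₂) (ℤ.- l₁) (ℤ.- l) c
  go idle                          = idle
  go (drop  {l = l}) rewrite eq l = take
  go (pass₁ {l = l}) rewrite eq l = pass₁
  go (pass₂ {l = l}) rewrite eq l = pass₂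
  go (take  {l = l}) rewrite eq l = drop

-- Only a `drop` in the second column can raise it above both of its neighbours. It needs a
-- non-empty carrier c′, which an `idle` first column cannot deliver, so the first column rises as
-- well.
plaq-compare : ∀ {c l l₁ l₂ l₁₂ c′ m m₁ m₂ m₁₂ c″} →
               Plaq c l l₁ l₂ l₁₂ c′ → Plaq c′ m m₁ m₂ m₁₂ c″ →
               m ℤ.≤ l → m₁ ℤ.≤ l₁ → m₂ ℤ.≤ l₂ → m₁₂ ℤ.≤ l₁₂
plaq-compare P idle  h h₁ h₂ = ℤ.≤-trans h (ℤ.≤-trans (plaq-l≤l₁ P) (plaq-l₁≤l₁₂ P))
plaq-compare P pass₁ h h₁ h₂ = ℤ.≤-trans h₁ (plaq-l₁≤l₁₂ P)
plaq-compare P pass₂ h h₁ h₂ = ℤ.≤-trans h₂ (plaq-l₂≤l₁₂ P)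
plaq-compare P take  h h₁ h₂ = ℤ.≤-trans h₁ (plaq-l₁≤l₁₂ P)
plaq-compare drop  drop h h₁ h₂ = ℤ.suc-mono h
plaq-compare pass₁ drop h h₁ h₂ = ℤ.suc-mono h
plaq-compare pass₂ drop h h₁ h₂ = ℤ.suc-mono h
plaq-compare take  drop h h₁ h₂ = ℤ.suc-mono h

plaq-det : ∀ {c l l₁ l₂ l₁₂ c′ d m m₁ m₂ m₁₂ d′} →
           Plaq c l l₁ l₂ l₁₂ c′ → Plaq d m m₁ m₂ m₁₂ d′ →
           c ≡ d → l ≡ m → l₁ ≡ m₁ → l₂ ≡ m₂ → l₁₂ ≡ m₁₂ × c′ ≡ d′
plaq-det P R refl refl refl refl = go P R refl refl
  where
  -- The equations on l₁ and l₂ stay arguments: with shared indices, matching on both faces would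
  -- have to unify `l` with `ℤ.suc l`.
  go : ∀ {c l l₁ l₂ l₁₂ c′ m₁ m₂ m₁₂ d′} →
       Plaq c l l₁ l₂ l₁₂ c′ → Plaq c l m₁ m₂ m₁₂ d′ →
       l₁ ≡ m₁ → l₂ ≡ m₂ → l₁₂ ≡ m₁₂ × c′ ≡ d′
  go idle  idle  e f = refl , refl
  go idle  pass₁ e f = ⊥-elim (ℤ.i≢suc[i] e)
  go idle  pass₂ e f = ⊥-elim (ℤ.i≢suc[i] f)
  go idle  take  e f = ⊥-elim (ℤ.i≢suc[i] e)
  go drop  drop  e f = refl , refl
  go drop  pass₁ e f = ⊥-elim (ℤ.i≢suc[i] e)
  go drop  pass₂ e f = ⊥-elim (ℤ.i≢suc[i] f)
  go drop  take  e f = ⊥-elim (ℤ.i≢suc[i] e)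
  go pass₁ idle  e f = ⊥-elim (ℤ.i≢suc[i] (sym e))
  go pass₁ drop  e f = ⊥-elim (ℤ.i≢suc[i] (sym e))
  go pass₁ pass₁ e f = refl , refl
  go pass₁ pass₂ e f = ⊥-elim (ℤ.i≢suc[i] (sym e))
  go pass₁ take  e f = ⊥-elim (ℤ.i≢suc[i] f)
  go pass₂ idle  e f = ⊥-elim (ℤ.i≢suc[i] (sym f))
  go pass₂ drop  e f = ⊥-elim (ℤ.i≢suc[i] (sym f))
  go pass₂ pass₁ e f = ⊥-elim (ℤ.i≢suc[i] e)
  go pass₂ pass₂ e f = refl , refl
  go pass₂ take  e f = ⊥-elim (ℤ.i≢suc[i] e)
  go take  idle  e f = ⊥-elim (ℤ.i≢suc[i] (sym e))
  go take  drop  e f = ⊥-elim (ℤ.i≢suc[i] (sym e))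
  go take  pass₁ e f = ⊥-elim (ℤ.i≢suc[i] (sym f))
  go take  pass₂ e f = ⊥-elim (ℤ.i≢suc[i] (sym e))
  go take  take  e f = refl , refl

suc-cancel-≤ : ∀ {x y} → ℤ.suc x ℤ.≤ ℤ.suc y → x ℤ.≤ y
suc-cancel-≤ {x} {y} h = subst₂ ℤ._≤_ (ℤ.pred-suc x) (ℤ.pred-suc y) (ℤ.pred-mono h)

-- A single column over the whole lattice

Column : (Point → ℕ) → (Point → ℤ) → (Point → ℕ) → Set
Column c L c′ =
  ∀ p → Plaq (c p) (L p) (L (p +e₁)) (L (p +e₂)) (L (p +e₁ +e₂)) (c′ p)

Past Future : (Point → ℤ) → ℤ → Set
Past   L h = ∃[ s ] ∀ p → time p ℤ.≤ s → L p ≡ h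
Future L h = ∃[ s ] ∀ p → s ℤ.≤ time p → L p ≡ h

PastZero FutureZero : (Point → ℕ) → Set
PastZero   c = ∃[ s ] ∀ p → time p ℤ.≤ s → c p ≡ 0
FutureZero c = ∃[ s ] ∀ p → s ℤ.≤ time p → c p ≡ 0

Periodic : ∀ {A : Set} → ℕ → (Point → A) → Set
Periodic n f = ∀ k p → f (shift n k p) ≡ f p

neg opposite : Point → Point
neg (x , y) = ℤ.- x , ℤ.- y
-- The corner of the face which is the image under neg of the face at p.
opposite p = neg (p +e₁ +e₂)

neg-involutive : ∀ p → neg (neg p) ≡ p
neg-involutive (x , y) = cong₂ _,_ (ℤ.neg-involutive x) (ℤ.neg-involutive y)

suc-neg-suc : ∀ x → ℤ.suc (ℤ.- ℤ.suc x) ≡ ℤ.- x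
suc-neg-suc = eq
  where
  eq : ∀ x → 1ℤ ℤ.+ (ℤ.- (1ℤ ℤ.+ x)) ≡ ℤ.- x
  eq = solve-∀

opposite-involutive : ∀ p → opposite (opposite p) ≡ p
opposite-involutive (x , y) = cong₂ _,_ (eq x) (eq y)
  where
  eq : ∀ x → ℤ.- ℤ.suc (ℤ.- ℤ.suc x) ≡ x
  eq x = trans (cong ℤ.-_ (suc-neg-suc x)) (ℤ.neg-involutive x)

time-neg : ∀ p → time (neg p) ≡ ℤ.- time p
time-neg (x , y) = sym (ℤ.neg-distrib-+ x y)

neg-≤-swap : ∀ {x y} → ℤ.- x ℤ.≤ y → ℤ.- y ℤ.≤ x
neg-≤-swap {x} h = subst (_ ℤ.≤_) (ℤ.neg-involutive x) (ℤ.neg-mono-≤ h)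

≤-neg-swap : ∀ {x y} → x ℤ.≤ ℤ.- y → y ℤ.≤ ℤ.- x
≤-neg-swap {y = y} h = subst (ℤ._≤ _) (ℤ.neg-involutive y) (ℤ.neg-mono-≤ h)

reflect : (Point → ℤ) → Point → ℤ
reflect L p = ℤ.- L (neg p)

past-reflect : ∀ {L h} → Future L h → Past (reflect L) (ℤ.- h)
past-reflect (s , F) = ℤ.- s , λ p h → cong ℤ.-_
  (F (neg p) (subst (s ℤ.≤_) (sym (time-neg p)) (≤-neg-swap h)))

future-reflect : ∀ {L h} → Past L h → Future (reflect L) (ℤ.- h)
future-reflect (s , F) = ℤ.- s , λ p h → cong ℤ.-_
  (F (neg p) (subst (ℤ._≤ s) (sym (time-neg p)) (neg-≤-swap h)))

futureZero-opposite : ∀ {c} → PastZero c → FutureZero (c ∘ opposite)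
futureZero-opposite (s , Z) = ℤ.- s , λ p h →
  Z (opposite p) (subst (ℤ._≤ s) (sym (time-neg (p +e₁ +e₂)))
    (neg-≤-swap (ℤ.≤-trans h (time-≤-+e₁+e₂ p))))

time-opposite : ∀ p → ℤ.suc (ℤ.suc (time (opposite p))) ≡ ℤ.- time p
time-opposite p = trans (cong (ℤ.suc ∘ ℤ.suc)
  (trans (time-neg (p +e₁ +e₂)) (cong ℤ.-_ (time-+e₁+e₂ p)))) (eq (time p))
  where
  eq : ∀ x → 1ℤ ℤ.+ (1ℤ ℤ.+ (ℤ.- (1ℤ ℤ.+ (1ℤ ℤ.+ x)))) ≡ ℤ.- x
  eq = solve-∀

pastZero-opposite : ∀ {c} → FutureZero c → PastZero (c ∘ opposite)
-- The reflected face has the corner - p - e₁ - e₂, of time - `time p` - 2; hence the shift of the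
-- bound by two.
pastZero-opposite (s , Z) = ℤ.- ℤ.suc (ℤ.suc s) , λ p h →
  Z (opposite p) (suc-cancel-≤ (suc-cancel-≤
    (subst (ℤ.suc (ℤ.suc s) ℤ.≤_) (sym (time-opposite p)) (≤-neg-swap h))))

column-reflect : ∀ {c L c′} → Column c L c′ →
                 Column (c′ ∘ opposite) (reflect L) (c ∘ opposite)
column-reflect {c} {L} {c′} C p@(x , y) =
  plaq-≡ (cong₂ _,_ (suc-neg-suc x) (suc-neg-suc y)) (cong (_ ,_) (suc-neg-suc y))
         (cong (_, _) (suc-neg-suc x)) (plaq-reflect (C (opposite p)))
  where
  plaq-≡ : ∀ {c c′ l u v w u′ v′ w′} → u ≡ u′ → v ≡ v′ → w ≡ w′ →
           Plaq c (ℤ.- L u) (ℤ.- L v) (ℤ.- L w) l c′ →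
           Plaq c (ℤ.- L u′) (ℤ.- L v′) (ℤ.- L w′) l c′
  plaq-≡ refl refl refl P = P

column-shift : ∀ {c L c′} d → Column c L c′ → Column c (λ p → L p ℤ.+ d) c′
column-shift d C p = plaq-shift d (C p)

column-compare : ∀ {c L c′ M c″} → Column c L c′ → Column c′ M c″ →
                 ∀ s → (∀ p → time p ℤ.≤ s → M p ℤ.≤ L p) → ∀ p → M p ℤ.≤ L p
column-compare C D s base = past-induction _ s base
  (λ q h h₁ h₂ → plaq-compare (C q) (D q) h h₁ h₂)

column-compare-past : ∀ {c L c′ M c″ h k} → Column c L c′ → Column c′ M c″ →
                      Past L h → Past M k → k ℤ.≤ h → ∀ p → M p ℤ.≤ L p
column-compare-past C D (s , pL) (t , pM) k≤h = column-compare C D (s ℤ.⊓ t)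
  (λ p h → subst₂ ℤ._≤_ (sym (pM p (ℤ.≤-trans h (ℤ.i⊓j≤j s t))))
                        (sym (pL p (ℤ.≤-trans h (ℤ.i⊓j≤i s t)))) k≤h)

open Algebra.Properties.Group (AbelianGroup.group ℤ.+-0-abelianGroup) using ()
  renaming (∙-cancelˡ to +-cancelˡ; ∙-cancelʳ to +-cancelʳ)

past-normalise : ∀ {L h} → Past L h → Past (λ p → L p ℤ.- h) 0ℤ
past-normalise {h = h} (s , pL) = s , λ p t → trans (cong (ℤ._- h) (pL p t)) (ℤ.+-inverseʳ h)

future-point : ∀ {L M h k} → Future L h → Future M k → ∃[ p ] L p ≡ h × M p ≡ k
future-point (s , fL) (t , fM) = (s ℤ.⊔ t , 0ℤ) ,
  fL _ (subst (s ℤ.≤_) (sym (ℤ.+-identityʳ _)) (ℤ.i≤i⊔j s t)) ,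
  fM _ (subst (t ℤ.≤_) (sym (ℤ.+-identityʳ _)) (ℤ.i≤j⊔i s t))

past-point : ∀ {L M h k} → Past L h → Past M k → ∃[ p ] L p ≡ h × M p ≡ k
past-point (s , pL) (t , pM) = (s ℤ.⊓ t , 0ℤ) ,
  pL _ (subst (ℤ._≤ s) (sym (ℤ.+-identityʳ _)) (ℤ.i⊓j≤i s t)) ,
  pM _ (subst (ℤ._≤ t) (sym (ℤ.+-identityʳ _)) (ℤ.i⊓j≤j s t))

-- Both columns are lowered to start from 0. The first then dominates the second everywhere, and at
-- a common late point their values are the two heights.
height-≤ : ∀ {c L c′ M c″ h h′ k k′} → Column c L c′ → Column c′ M c″ →
           Past L h → Future L h′ → Past M k → Future M k′ →
           k′ ℤ.- k ℤ.≤ h′ ℤ.- h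
height-≤ {h = h} {k = k} C D pL fL pM fM with p , e , f ← future-point fL fM =
  subst₂ ℤ._≤_ (cong (ℤ._- k) f) (cong (ℤ._- h) e)
    (column-compare-past (column-shift (ℤ.- h) C) (column-shift (ℤ.- k) D)
      (past-normalise pL) (past-normalise pM) ℤ.≤-refl p)

-- The reverse inequality is height-≤ for the reflected columns.
height-conserved : ∀ {c L c′ M c″ h h′ k k′} → Column c L c′ → Column c′ M c″ →
                   Past L h → Future L h′ → Past M k → Future M k′ →
                   k′ ℤ.- k ≡ h′ ℤ.- h
height-conserved {h = h} {h′} {k} {k′} C D pL fL pM fM =
  ℤ.≤-antisym (height-≤ C D pL fL pM fM)
    (subst₂ ℤ._≤_ (eq h h′) (eq k k′)
      (height-≤ (column-reflect D) (column-reflect C) (past-reflect fM) (future-reflect pM)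
                (past-reflect fL) (future-reflect pL)))
  where
  eq : ∀ h h′ → (ℤ.- h) ℤ.- (ℤ.- h′) ≡ h′ ℤ.- h
  eq = solve-∀

column-det : ∀ {c L c′ d M d′ h} → Column c L c′ → Column d M d′ →
             (∀ p → c p ≡ d p) → Past L h → Past M h →
             (∀ p → L p ≡ M p) × (∀ p → c′ p ≡ d′ p)
column-det {L = L} {M = M} C D c≡d (s , pL) (t , pM) = L≡M , λ p →
  proj₂ (plaq-det (C p) (D p) (c≡d p) (L≡M p) (L≡M (p +e₁)) (L≡M (p +e₂)))
  where
  L≡M : ∀ p → L p ≡ M p
  L≡M = past-induction _ (s ℤ.⊓ t)
    (λ p h → trans (pL p (ℤ.≤-trans h (ℤ.i⊓j≤i s t)))
                   (sym (pM p (ℤ.≤-trans h (ℤ.i⊓j≤j s t)))))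
    (λ q e e₁ e₂ → proj₁ (plaq-det (C q) (D q) (c≡d q) e e₁ e₂))

-- Read backwards, the columns start from h′ and k′, which are not known to agree. Subtracting these
-- values gives reflected columns with the common past 0, hence L - h′ = M - k′; at an early point,
-- where both lengths are h, this forces h′ = k′.
column-det-back : ∀ {c L c′ d M d′ h h′ k′} → Column c L c′ → Column d M d′ →
                  (∀ p → c′ p ≡ d′ p) → Past L h → Past M h → Future L h′ → Future M k′ →
                  (∀ p → L p ≡ M p) × (∀ p → c p ≡ d p)
column-det-back {c} {L} {d = d} {M} {h = h} {h′} {k′} C D c′≡d′ pL pM fL fM =
  L≡M , λ p → subst (λ q → c q ≡ d q) (opposite-involutive p) (proj₂ reflected (opposite p))
  where
  shifted : ∀ {M k′} → Future M k′ → Past (reflect (λ p → M p ℤ.- k′)) 0ℤ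
  shifted {M} {k′} (s , fM) =
    past-reflect {λ p → M p ℤ.- k′} {0ℤ} (s , λ p t → trans (cong (ℤ._- k′) (fM p t)) (ℤ.+-inverseʳ k′))
  reflected = column-det (column-reflect (column-shift (ℤ.- h′) C))
                         (column-reflect (column-shift (ℤ.- k′) D))
                         (c′≡d′ ∘ opposite) (shifted fL) (shifted fM)
  L-h′≡M-k′ : ∀ p → L p ℤ.- h′ ≡ M p ℤ.- k′
  L-h′≡M-k′ p = subst (λ q → L q ℤ.- h′ ≡ M q ℤ.- k′) (neg-involutive p)
                      (ℤ.neg-injective (proj₁ reflected (neg p)))
  h′≡k′ : h′ ≡ k′
  h′≡k′ with p , e , f ← past-point pL pM =
    ℤ.neg-injective (+-cancelˡ h _ _
      (subst₂ (λ u v → u ℤ.- h′ ≡ v ℤ.- k′) e f (L-h′≡M-k′ p)))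
  L≡M : ∀ p → L p ≡ M p
  L≡M p = +-cancelʳ (ℤ.- h′) (L p) (M p)
            (trans (L-h′≡M-k′ p) (cong (λ z → M p ℤ.- z) (sym h′≡k′)))

-- A face at time s reaches up to time s + 2, and on flat faces an empty carrier stays empty. The
-- leaving load inherits the bound s itself, so the bound does not deteriorate from column to
-- column.
column-quiet : ∀ {c L c′ h} → Column c L c′ → Past L h →
               ∀ s → (∀ p → time p ℤ.≤ s → c p ≡ 0) →
               (∀ p → time p ℤ.≤ ℤ.suc (ℤ.suc s) → L p ≡ h) ×
               (∀ p → time p ℤ.≤ s → c′ p ≡ 0)
column-quiet {c} {L} {c′} {h} C (s₀ , pL) s Z = flat , λ p t →
  trans (proj₁ (plaq-flat (C p)
                  (trans (flat (p +e₁) (≤₁ p t)) (sym (flat p (≤₀ p t))))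
                  (trans (flat (p +e₂) (≤₂ p t)) (sym (flat p (≤₀ p t))))))
        (cong (_∸ 1) (Z p t))
  where
  ≤₀ : ∀ p → time p ℤ.≤ s → time p ℤ.≤ ℤ.suc (ℤ.suc s)
  ≤₀ p t = ≤-suc (≤-suc t)
  ≤₁ : ∀ p → time p ℤ.≤ s → time (p +e₁) ℤ.≤ ℤ.suc (ℤ.suc s)
  ≤₁ p t = ≤-suc (subst (ℤ._≤ _) (sym (time-+e₁ p)) (ℤ.suc-mono t))
  ≤₂ : ∀ p → time p ℤ.≤ s → time (p +e₂) ℤ.≤ ℤ.suc (ℤ.suc s)
  ≤₂ p t = ≤-suc (subst (ℤ._≤ _) (sym (time-+e₂ p)) (ℤ.suc-mono t))
  flat : ∀ p → time p ℤ.≤ ℤ.suc (ℤ.suc s) → L p ≡ h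
  flat = past-induction _ s₀ (λ p h _ → pL p h) step
    where
    step : ∀ q → _ → _ → _ → time (q +e₁ +e₂) ℤ.≤ ℤ.suc (ℤ.suc s) → L (q +e₁ +e₂) ≡ h
    step q i i₁ i₂ t = trans (proj₂ (plaq-flat (C q)
        (trans (i₁ (≤₁ q t′)) (sym (i (≤₀ q t′)))) (trans (i₂ (≤₂ q t′)) (sym (i (≤₀ q t′)))))
        (Z q t′)) (i (≤₀ q t′))
      where
      t′ : time q ℤ.≤ s
      t′ = suc-cancel-≤ (suc-cancel-≤ (subst (ℤ._≤ _) (time-+e₁+e₂ q) t))

-- Once the length is constant the four corners of a face agree, and the only such face is `idle`.
column-futureZero : ∀ {c L c′ h} → Column c L c′ → Future L h →
                    FutureZero c × FutureZero c′
column-futureZero {c} {L} {c′} C (s , F) =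
  (s , λ p t → proj₁ (zeros p t)) , (s , λ p t → proj₂ (zeros p t))
  where
  zeros : ∀ p → s ℤ.≤ time p → c p ≡ 0 × c′ p ≡ 0
  zeros p t = plaq-idle (C p)
    (ℤ.≤-reflexive (trans (F _ (ℤ.≤-trans t (time-≤-+e₁+e₂ p))) (sym (F p t))))

column-pastZero : ∀ {c L c′ h} → Column c L c′ → Past L h →
                  PastZero c × PastZero c′
column-pastZero {c} {L} {c′} C pL
  with zc′ , zc ← column-futureZero (column-reflect C) (future-reflect pL) =
  unreflect zc , unreflect zc′
  where
  unreflect : ∀ {c} → FutureZero (c ∘ opposite) → PastZero c
  unreflect {c} z with s , Z ← pastZero-opposite z =
    s , λ p t → subst (λ q → c q ≡ 0) (opposite-involutive p) (Z p t)

-- Periodic columns become constant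

column-≤ : ∀ {c L c′} → Column c L c′ → ∀ p i j →
           L p ℤ.≤ L (proj₁ p ℤ.+ + i , proj₂ p ℤ.+ + j)
column-≤ {L = L} C (x , y) zero zero =
  ℤ.≤-reflexive (cong L (cong₂ _,_ (sym (ℤ.+-identityʳ x)) (sym (ℤ.+-identityʳ y))))
column-≤ {L = L} C (x , y) (suc i) j = ℤ.≤-trans (plaq-l≤l₁ (C (x , y)))
  (subst (λ z → _ ℤ.≤ L (z , _)) (eq x (+ i)) (column-≤ C (ℤ.suc x , y) i j))
  where
  eq : ∀ x i → (1ℤ ℤ.+ x) ℤ.+ i ≡ x ℤ.+ (1ℤ ℤ.+ i)
  eq = solve-∀
column-≤ {L = L} C (x , y) zero (suc j) = ℤ.≤-trans (plaq-l≤l₂ (C (x , y)))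
  (subst (λ z → _ ℤ.≤ L (_ , z)) (eq y (+ j)) (column-≤ C (x , ℤ.suc y) zero j))
  where
  eq : ∀ x i → (1ℤ ℤ.+ x) ℤ.+ i ≡ x ℤ.+ (1ℤ ℤ.+ i)
  eq = solve-∀

-- The translate is chosen by dividing the horizontal distance by n. The remainder is less than n,
-- so a time difference of at least n leaves a non-negative vertical distance.
shift-below : ∀ n .{{_ : ℕ.NonZero n}} u q → time u ℤ.+ + n ℤ.≤ time q →
              ∃[ k ] ∃[ i ] ∃[ j ]
                q ≡ (proj₁ (shift n k u) ℤ.+ + i , proj₂ (shift n k u) ℤ.+ + j)
shift-below n (ux , uy) (qx , qy) h = k , r , ℤ.∣ Δ ∣ , cong₂ _,_ ex ey
  where
  k : ℤ
  k = (qx ℤ.- ux) ℤ./ℕ n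
  r : ℕ
  r = (qx ℤ.- ux) ℤ.%ℕ n
  Δ : ℤ
  Δ = (qy ℤ.- uy) ℤ.+ k ℤ.* + n
  divmod : qx ℤ.- ux ≡ + r ℤ.+ k ℤ.* + n
  divmod = ℤ.a≡a%ℕn+[a/ℕn]*n (qx ℤ.- ux) n
  ex : qx ≡ (ux ℤ.+ k ℤ.* + n) ℤ.+ + r
  ex = trans (eq qx ux) (trans (cong (λ z → ux ℤ.+ z) divmod) (eq′ ux (+ r) (k ℤ.* + n)))
    where
    eq : ∀ q u → q ≡ u ℤ.+ (q ℤ.- u)
    eq = solve-∀
    eq′ : ∀ u r k → u ℤ.+ (r ℤ.+ k) ≡ (u ℤ.+ k) ℤ.+ r
    eq′ = solve-∀
  r≤ : + r ℤ.≤ (qx ℤ.+ qy) ℤ.- (ux ℤ.+ uy)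
  r≤ = ℤ.≤-trans (ℤ.+≤+ (ℕ.<⇒≤ (ℤ.n%ℕd<d (qx ℤ.- ux) n)))
         (subst (ℤ._≤ _) (eq (ux ℤ.+ uy) (+ n)) (ℤ.+-monoˡ-≤ (ℤ.- (ux ℤ.+ uy)) h))
    where
    eq : ∀ t n → (t ℤ.+ n) ℤ.- t ≡ n
    eq = solve-∀
  0≤Δ : 0ℤ ℤ.≤ Δ
  0≤Δ = subst (0ℤ ℤ.≤_) eΔ (ℤ.i≤j⇒0≤j-i r≤)
    where
    eq : ∀ qx qy ux uy r → ((qx ℤ.+ qy) ℤ.- (ux ℤ.+ uy)) ℤ.- r
                         ≡ ((qx ℤ.- ux) ℤ.- r) ℤ.+ (qy ℤ.- uy)
    eq = solve-∀
    eq′ : ∀ r k z → ((r ℤ.+ k) ℤ.- r) ℤ.+ z ≡ z ℤ.+ k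
    eq′ = solve-∀
    eΔ : ((qx ℤ.+ qy) ℤ.- (ux ℤ.+ uy)) ℤ.- + r ≡ Δ
    eΔ = trans (eq qx qy ux uy (+ r))
           (trans (cong (λ z → (z ℤ.- + r) ℤ.+ (qy ℤ.- uy)) divmod) (eq′ (+ r) (k ℤ.* + n) (qy ℤ.- uy)))
  ey : qy ≡ (uy ℤ.- k ℤ.* + n) ℤ.+ + ℤ.∣ Δ ∣
  ey = trans (eq qy uy (k ℤ.* + n)) (cong (λ z → (uy ℤ.- k ℤ.* + n) ℤ.+ z) (sym (ℤ.0≤i⇒+∣i∣≡i 0≤Δ)))
    where
    eq : ∀ q u z → q ≡ (u ℤ.- z) ℤ.+ ((q ℤ.- u) ℤ.+ z)
    eq = solve-∀

-- Monotonicity along lattice paths only compares points of a quadrant; periodicity extends it to a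
-- half plane.
column-dominate : ∀ {n c L c′} .{{_ : ℕ.NonZero n}} → Column c L c′ → Periodic n L →
                  ∀ u q → time u ℤ.+ + n ℤ.≤ time q → L u ℤ.≤ L q
column-dominate {n} {c} {L} {c′} C per u q h with k , i , j , refl ← shift-below n u q h =
  subst (ℤ._≤ L q) (per k u) (column-≤ {c} {L} {c′} C (shift n k u) i j)

-- When no load enters, the new length at a face is one of the two adjacent
-- ones.  So every length occurs at some point of time at most s + 1, and by
-- periodicity it is then a lower bound for all lengths from time s + 1 + n on.
column-future : ∀ {n c L c′} .{{_ : ℕ.NonZero n}} → Column c L c′ → Periodic n L →
                FutureZero c → ∃[ h ] Future L h
column-future {n} {c} {L} C per (s , Z) = L p₀ , e , λ p t →
  ℤ.≤-antisym (≤L p p₀ (subst (e ℤ.≤_) (sym (ℤ.+-identityʳ e)) ℤ.≤-refl)) (≤L p₀ p t)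
  where
  e : ℤ
  e = ℤ.suc s ℤ.+ + n
  p₀ : Point
  p₀ = e , 0ℤ
  Early : Point → Set
  Early p = ∃[ u ] time u ℤ.≤ ℤ.suc s × L u ≡ L p
  early : ∀ p → Early p
  early = past-induction Early (ℤ.suc s) (λ p h → p , h , refl) step
    where
    step : ∀ q → Early q → Early (q +e₁) → Early (q +e₂) → Early (q +e₁ +e₂)
    step q _ (u , h , f) (v , k , g) with s ℤ.≤? time q
    ... | yes s≤ with plaq-empty (C q) (Z q s≤)
    ...   | inj₁ e = u , h , trans f (sym e)
    ...   | inj₂ e = v , k , trans g (sym e)
    step q _ _ _ | no s≰ = q +e₁ +e₂ ,
      subst (ℤ._≤ ℤ.suc s) (sym (time-+e₁+e₂ q)) (ℤ.suc-mono (≰⇒suc≤ s≰)) , refl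
  ≤L : ∀ p q → e ℤ.≤ time q → L p ℤ.≤ L q
  ≤L p q h with u , t , f ← early p =
    subst (ℤ._≤ L q) f (column-dominate C per u q (ℤ.≤-trans (ℤ.+-monoˡ-≤ (+ n) t) h))

periodic-reflect : ∀ {n L} → Periodic n L → Periodic n (reflect L)
periodic-reflect {n} {L} per k p@(x , y) = cong ℤ.-_
  (trans (cong L (cong₂ _,_ (eq x k (+ n)) (eq′ y k (+ n)))) (per (ℤ.- k) (neg p)))
  where
  eq : ∀ x k n → ℤ.- (x ℤ.+ k ℤ.* n) ≡ ℤ.- x ℤ.+ (ℤ.- k) ℤ.* n
  eq = solve-∀
  eq′ : ∀ y k n → ℤ.- (y ℤ.- k ℤ.* n) ≡ ℤ.- y ℤ.- (ℤ.- k) ℤ.* n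
  eq′ = solve-∀

column-past : ∀ {n c L c′} .{{_ : ℕ.NonZero n}} → Column c L c′ → Periodic n L →
              PastZero c′ → ∃[ h ] Past L h
column-past {n} {c} {L} {c′} C per z =
  let h , F     = column-future {n} {c′ ∘ opposite} {reflect L} {c ∘ opposite}
                    (column-reflect {c} {L} {c′} C) (periodic-reflect per)
                    (futureZero-opposite {c′} z)
      s , early = past-reflect {reflect L} F
  in ℤ.- h , s , λ p t →
     trans (sym (trans (ℤ.neg-involutive _) (cong L (neg-involutive p)))) (early p t)

-- Signatures and their conjugates

Descending : ∀ {ℓ} → Vec ℤ ℓ → Set
Descending xs = ∀ i j → toℕ i ℕ.≤ toℕ j → lookup xs j ℤ.≤ lookup xs i

-- `sorted` is irrelevant, but order on ℤ is decidable, so the proof can be recomputed.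
parts-descending : ∀ {ℓ} (ν : Signature ℓ) → Descending (parts ν)
parts-descending (mkSignature xs s) i j i≤j = recompute (lookup xs j ℤ.≤? lookup xs i) (s i j i≤j)

count-none : ∀ {ℓ} x (xs : Vec ℤ ℓ) → (∀ i → ¬ x ℤ.≤ lookup xs i) → Vec.count (x ℤ.≤?_) xs ≡ 0
count-none x []       h = refl
count-none x (y ∷ ys) h with x ℤ.≤? y
... | yes x≤y = contradiction x≤y (h zero)
... | no  _   = count-none x ys (h ∘ suc)

≤lookup⇒<count : ∀ {ℓ} x (xs : Vec ℤ ℓ) → Descending xs →
                 ∀ i → x ℤ.≤ lookup xs i → toℕ i ℕ.< Vec.count (x ℤ.≤?_) xs
≤lookup⇒<count x (y ∷ ys) d i h with x ℤ.≤? y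
≤lookup⇒<count x (y ∷ ys) d zero    h | yes _   = s≤s z≤n
≤lookup⇒<count x (y ∷ ys) d (suc i) h | yes _   =
  s≤s (≤lookup⇒<count x ys (λ i j k → d (suc i) (suc j) (s≤s k)) i h)
≤lookup⇒<count x (y ∷ ys) d i       h | no  x≰y =
  contradiction (ℤ.≤-trans h (d zero i z≤n)) x≰y

<count⇒≤lookup : ∀ {ℓ} x (xs : Vec ℤ ℓ) → Descending xs →
                 ∀ i → toℕ i ℕ.< Vec.count (x ℤ.≤?_) xs → x ℤ.≤ lookup xs i
<count⇒≤lookup x (y ∷ ys) d i       h with x ℤ.≤? y
<count⇒≤lookup x (y ∷ ys) d zero    h | yes x≤y = x≤y
<count⇒≤lookup x (y ∷ ys) d (suc i) (s≤s h) | yes _ =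
  <count⇒≤lookup x ys (λ i j k → d (suc i) (suc j) (s≤s k)) i h
<count⇒≤lookup x (y ∷ ys) d i       h | no x≰y = contradiction
  (subst (toℕ i ℕ.<_) (count-none x ys λ j x≤ → x≰y (ℤ.≤-trans x≤ (d zero (suc j) z≤n))) h) λ ()

-- With its converse below, this is the dictionary between rows and columns: x ≤ νᵢ exactly when i <
-- ν′ₓ, rows being counted from 0.
≤part⇒<conj : ∀ {ℓ} (ν : Signature ℓ) {x} i → x ℤ.≤ part ν i → toℕ i ℕ.< conj ν x
≤part⇒<conj ν = ≤lookup⇒<count _ (parts ν) (parts-descending ν)

<conj⇒≤part : ∀ {ℓ} (ν : Signature ℓ) {x} i → toℕ i ℕ.< conj ν x → x ℤ.≤ part ν i
<conj⇒≤part ν = <count⇒≤lookup _ (parts ν) (parts-descending ν)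

conj≤ℓ : ∀ {ℓ} (ν : Signature ℓ) x → conj ν x ℕ.≤ ℓ
conj≤ℓ ν x = Vec.count≤n (x ℤ.≤?_) (parts ν)

-- Row a - 1 is the witness. It reduces inequalities between conjugates to statements about single
-- rows.
≤-from-Fin : ∀ {ℓ a b} → a ℕ.≤ ℓ → (∀ (i : Fin ℓ) → toℕ i ℕ.< a → toℕ i ℕ.< b) → a ℕ.≤ b
≤-from-Fin {a = zero}      a≤ℓ h = z≤n
≤-from-Fin {a = suc a} {b} a<ℓ h = subst (ℕ._< b) (Fin.toℕ-fromℕ< a<ℓ)
  (h (fromℕ< a<ℓ) (subst (ℕ._< suc a) (sym (Fin.toℕ-fromℕ< a<ℓ)) ℕ.≤-refl))

conj-antitone : ∀ {ℓ} (ν : Signature ℓ) {x y} → x ℤ.≤ y → conj ν y ℕ.≤ conj ν x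
conj-antitone ν x≤y = ≤-from-Fin (conj≤ℓ ν _)
  (λ i h → ≤part⇒<conj ν i (ℤ.≤-trans x≤y (<conj⇒≤part ν i h)))

lower-bound : ∀ {ℓ} (xs : Vec ℤ ℓ) → ∃[ a ] ∀ i → a ℤ.≤ lookup xs i
lower-bound []       = 0ℤ , λ ()
lower-bound (x ∷ xs) with a , a≤ ← lower-bound xs = x ℤ.⊓ a , λ where
  zero    → ℤ.i⊓j≤i x a
  (suc i) → ℤ.≤-trans (ℤ.i⊓j≤j x a) (a≤ i)

upper-bound : ∀ {ℓ} (xs : Vec ℤ ℓ) → ∃[ b ] ∀ i → lookup xs i ℤ.≤ b
upper-bound []       = 0ℤ , λ ()
upper-bound (x ∷ xs) with b , ≤b ← upper-bound xs = x ℤ.⊔ b , λ where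
  zero    → ℤ.i≤i⊔j x b
  (suc i) → ℤ.≤-trans (≤b i) (ℤ.i≤j⊔i x b)

conj-full : ∀ {ℓ} (ν : Signature ℓ) → ∃[ a ] ∀ x → x ℤ.≤ a → conj ν x ≡ ℓ
conj-full ν with a , a≤ ← lower-bound (parts ν) = a , λ x x≤a →
  ℕ.≤-antisym (conj≤ℓ ν x)
    (≤-from-Fin ℕ.≤-refl (λ i _ → ≤part⇒<conj ν i (ℤ.≤-trans x≤a (a≤ i))))

conj-empty : ∀ {ℓ} (ν : Signature ℓ) → ∃[ b ] ∀ x → b ℤ.≤ x → conj ν x ≡ 0
conj-empty ν with b , ≤b ← upper-bound (parts ν) = ℤ.suc b , λ x b<x →
  ℕ.n≤0⇒n≡0 (≤-from-Fin (conj≤ℓ ν x)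
    (λ i h → contradiction (ℤ.≤-trans b<x (ℤ.≤-trans (<conj⇒≤part ν i h) (≤b i))) suc≰))

signature-≡ : ∀ {ℓ} {κ μ : Signature ℓ} → parts κ ≡ parts μ → κ ≡ μ
signature-≡ {κ = mkSignature _ _} {mkSignature _ _} refl = refl

lookup-injective : ∀ {A : Set} {ℓ} (xs ys : Vec A ℓ) → (∀ i → lookup xs i ≡ lookup ys i) → xs ≡ ys
lookup-injective xs ys h = trans (sym (Vec.tabulate∘lookup xs))
  (trans (Vec.tabulate-cong h) (Vec.tabulate∘lookup ys))

conj-injective : ∀ {ℓ} {κ μ : Signature ℓ} → (∀ x → conj κ x ≡ conj μ x) → κ ≡ μ
conj-injective {κ = κ} {μ} h = signature-≡ (lookup-injective _ _ λ i →
  ℤ.≤-antisym (<conj⇒≤part μ i (subst (toℕ i ℕ.<_) (h _) (≤part⇒<conj κ i ℤ.≤-refl)))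
              (<conj⇒≤part κ i (subst (toℕ i ℕ.<_) (sym (h _)) (≤part⇒<conj μ i ℤ.≤-refl))))

-- The number of rows is the value of the conjugate far to the left, so it need not be known
-- beforehand to be the same.
conj-injective-𝕊 : ∀ {κ μ : 𝕊} → (∀ x → conj (proj₂ κ) x ≡ conj (proj₂ μ) x) → κ ≡ μ
conj-injective-𝕊 {k , κ} {m , μ} h
  with a , full ← conj-full κ | b , full′ ← conj-full μ
  with refl ← trans (sym (full (a ℤ.⊓ b) (ℤ.i⊓j≤i a b)))
                (trans (h (a ℤ.⊓ b)) (full′ (a ℤ.⊓ b) (ℤ.i⊓j≤j a b))) =
  cong (k ,_) (conj-injective h)

⪯-refl : ∀ {ℓ} {κ : Signature ℓ} → κ ⪯ κ
⪯-refl {κ = κ} = record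
  { below = λ i → ℤ.≤-refl
  ; above = λ i j e → parts-descending κ i j (subst (toℕ i ℕ.≤_) (sym e) (ℕ.n≤1+n _))
  }

⪯-recompute : ∀ {ℓ} {κ μ : Signature ℓ} → .(κ ⪯ μ) → κ ⪯ μ
⪯-recompute {κ = κ} {μ} h = record
  { below = λ i → recompute (part κ i ℤ.≤? part μ i) (_⪯_.below h i)
  ; above = λ i j e → recompute (part μ j ℤ.≤? part κ i) (_⪯_.above h i j e)
  }

⪯⇒conj-≤ : ∀ {ℓ} {κ μ : Signature ℓ} → κ ⪯ μ → ∀ x → conj κ x ℕ.≤ conj μ x
⪯⇒conj-≤ {κ = κ} {μ} h x = ≤-from-Fin (conj≤ℓ κ x) λ i i< →
  ≤part⇒<conj μ i (ℤ.≤-trans (<conj⇒≤part κ i i<) (_⪯_.below h i))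

⪯⇒conj-≤-suc : ∀ {ℓ} {κ μ : Signature ℓ} → κ ⪯ μ → ∀ x → conj μ x ℕ.≤ suc (conj κ x)
⪯⇒conj-≤-suc {κ = κ} {μ} h x = ≤-from-Fin (conj≤ℓ μ x) λ i i< →
  s≤s (go i (toℕ i) refl i<)
  where
  go : ∀ i k → toℕ i ≡ k → toℕ i ℕ.< conj μ x → k ℕ.≤ conj κ x
  go i zero    e i< = z≤n
  go i (suc k) e i< = subst (ℕ._< conj κ x) k′≡k
    (≤part⇒<conj κ k′ (ℤ.≤-trans (<conj⇒≤part μ i i<)
                                 (_⪯_.above h k′ i (trans e (cong suc (sym k′≡k))))))
    where
    k<ℓ : k ℕ.< _
    k<ℓ = ℕ.<-trans (ℕ.≤-reflexive (sym e)) (Fin.toℕ<n i)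
    k′ : Fin _
    k′ = fromℕ< k<ℓ
    k′≡k : toℕ k′ ≡ k
    k′≡k = Fin.toℕ-fromℕ< k<ℓ

conj⇒⪯ : ∀ {ℓ} {κ μ : Signature ℓ} → (∀ x → conj κ x ℕ.≤ conj μ x) →
         (∀ x → conj μ x ℕ.≤ suc (conj κ x)) → κ ⪯ μ
conj⇒⪯ {κ = κ} {μ} h h′ = record
  { below = λ i → <conj⇒≤part μ i (ℕ.<-≤-trans (≤part⇒<conj κ i ℤ.≤-refl) (h _))
  ; above = λ i j e → <conj⇒≤part κ i (ℕ.s≤s⁻¹ (ℕ.≤-trans
      (subst (λ k → suc k ℕ.≤ conj μ (part μ j)) e (≤part⇒<conj μ j ℤ.≤-refl)) (h′ _)))
  }

-- The signature with prescribed conjugate f: its row i is the largest column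
-- x in [a , a + k] with i < f x.
module FromConj {ℓ : ℕ} (f : ℤ → ℕ) (antitone : ∀ x → f x ℕ.≤ f (ℤ.pred x))
                (a b : ℤ) (full : ∀ x → x ℤ.≤ a → f x ≡ ℓ) (empty : ∀ x → b ℤ.≤ x → f x ≡ 0) where

  f-antitone : ∀ {x y} → x ℤ.≤ y → f y ℕ.≤ f x
  f-antitone {x} {y} = ℤ-ascend (λ y → x ℤ.≤ y → f y ℕ.≤ f x) x
    (λ y y≤x x≤y → ℕ.≤-reflexive (cong f (ℤ.≤-antisym y≤x x≤y))) step y
    where
    step : ∀ y → (x ℤ.≤ ℤ.pred y → f (ℤ.pred y) ℕ.≤ f x) → x ℤ.≤ y → f y ℕ.≤ f x
    step y ih x≤y with x ℤ.≤? ℤ.pred y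
    ... | yes h = ℕ.≤-trans (antitone y) (ih h)
    ... | no  h = ℕ.≤-reflexive (cong f (ℤ.≤-antisym
                    (subst (ℤ._≤ x) (ℤ.suc-pred y) (≰⇒suc≤ h)) x≤y))

  f≤ℓ : ∀ x → f x ℕ.≤ ℓ
  f≤ℓ x with x ℤ.≤? a
  ... | yes h = ℕ.≤-reflexive (full x h)
  ... | no  h = subst (f x ℕ.≤_) (full a ℤ.≤-refl) (f-antitone (ℤ.<⇒≤ (ℤ.≰⇒> h)))

  end : ℕ → ℕ → ℤ
  end i zero    = a
  end i (suc k) with i ℕ.<? f (a ℤ.+ + suc k)
  ... | yes _ = a ℤ.+ + suc k
  ... | no  _ = end i k

  <f-end : ∀ i k → i ℕ.< ℓ → i ℕ.< f (end i k)
  <f-end i zero    i<ℓ = subst (i ℕ.<_) (sym (full a ℤ.≤-refl)) i<ℓ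
  <f-end i (suc k) i<ℓ with i ℕ.<? f (a ℤ.+ + suc k)
  ... | yes h = h
  ... | no  _ = <f-end i k i<ℓ

  ≤end : ∀ i k x → x ℤ.≤ a ℤ.+ + k → i ℕ.< f x → x ℤ.≤ end i k
  ≤end i zero    x x≤ i< = subst (x ℤ.≤_) (ℤ.+-identityʳ a) x≤
  ≤end i (suc k) x x≤ i< with i ℕ.<? f (a ℤ.+ + suc k)
  ... | yes _ = x≤
  ... | no  h with x ℤ.≤? a ℤ.+ + k
  ...   | yes x≤′ = ≤end i k x x≤′ i<
  ...   | no  x≰  = contradiction (ℕ.<-≤-trans i< (f-antitone
                      (subst (ℤ._≤ x) (eq a (+ k)) (≰⇒suc≤ x≰)))) h
    where
    eq : ∀ a k → 1ℤ ℤ.+ (a ℤ.+ k) ≡ a ℤ.+ (1ℤ ℤ.+ k)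
    eq = solve-∀

  width : ℕ
  width = ℤ.∣ b ℤ.- a ∣

  <f⇒≤end : ∀ i x → i ℕ.< f x → x ℤ.≤ end i width
  <f⇒≤end i x i< with x ℤ.≤? b
  ... | yes x≤b = ≤end i width x (ℤ.≤-trans x≤b (≤+∣-∣ b a)) i<
  ... | no  x≰b = contradiction (subst (i ℕ.<_) (empty x (ℤ.<⇒≤ (ℤ.≰⇒> x≰b))) i<) λ ()

  ≤end⇒<f : ∀ i x → i ℕ.< ℓ → x ℤ.≤ end i width → i ℕ.< f x
  ≤end⇒<f i x i<ℓ x≤ = ℕ.<-≤-trans (<f-end i width i<ℓ) (f-antitone x≤)

  row-end : Fin ℓ → ℤ
  row-end i = end (toℕ i) width

  opaque
    fromConj : Signature ℓ
    fromConj = mkSignature (tabulate row-end) (λ i j i≤j →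
      subst₂ ℤ._≤_ (sym (Vec.lookup∘tabulate row-end j)) (sym (Vec.lookup∘tabulate row-end i))
        (<f⇒≤end (toℕ i) _ (ℕ.≤-<-trans i≤j (<f-end (toℕ j) width (Fin.toℕ<n j)))))

    conj-fromConj : ∀ x → conj fromConj x ≡ f x
    conj-fromConj x = ℕ.≤-antisym
      (≤-from-Fin (conj≤ℓ fromConj x) λ i h → ≤end⇒<f (toℕ i) x (Fin.toℕ<n i)
        (subst (x ℤ.≤_) (Vec.lookup∘tabulate row-end i) (<conj⇒≤part fromConj i h)))
      (≤-from-Fin (f≤ℓ x) λ i h → ≤part⇒<conj fromConj i
        (subst (x ℤ.≤_) (sym (Vec.lookup∘tabulate row-end i)) (<f⇒≤end (toℕ i) x h)))

open FromConj using (fromConj; conj-fromConj)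

-- The local rule on signatures

-- The carrier is arbitrary instead of being `load`, which makes the notion invariant under half
-- turns; `face-load` shows that there is no choice.
record Face {ℓ} (κ μ lam ν : Signature ℓ) : Set where
  constructor face
  field
    carrier   : ℤ → ℕ
    plaquette : ∀ x → Plaq (carrier (ℤ.pred x)) (+ conj κ x) (+ conj μ x)
                           (+ conj lam x) (+ conj ν x) (carrier x)

plaq-≡ : ∀ {c l l₁ l₂ l₁₂ c′ d m m₁ m₂ m₁₂ d′} → c ≡ d → l ≡ m → l₁ ≡ m₁ → l₂ ≡ m₂ →
         l₁₂ ≡ m₁₂ → c′ ≡ d′ → Plaq c l l₁ l₂ l₁₂ c′ → Plaq d m m₁ m₂ m₁₂ d′
plaq-≡ refl refl refl refl refl refl P = P

suc-∸ : ∀ k → suc k ∸ k ≡ 1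
suc-∸ k = ℕ.m+n∸n≡m 1 k

plaq-load : ∀ {c k m l v c′} → Plaq c (+ k) (+ m) (+ l) (+ v) c′ →
            c′ ≡ ((m ∸ k) ℕ.+ (l ∸ k) ℕ.+ c) ∸ 1
plaq-load (idle  {+ k})          rewrite ℕ.n∸n≡0 k           = refl
plaq-load (drop  {_} {+ k})      rewrite ℕ.n∸n≡0 k           = refl
plaq-load (pass₁ {_} {+ k})      rewrite ℕ.n∸n≡0 k | suc-∸ k = refl
plaq-load (pass₂ {_} {+ k})      rewrite ℕ.n∸n≡0 k | suc-∸ k = refl
plaq-load (take  {_} {+ k})      rewrite suc-∸ k             = refl

plaq-exists : ∀ c {k m l} → k ℕ.≤ m → m ℕ.≤ suc k → k ℕ.≤ l → l ℕ.≤ suc k →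
              ∃[ v ] ∃[ c′ ] Plaq c (+ k) (+ m) (+ l) (+ v) c′
plaq-exists c k≤m m≤ k≤l l≤ = go c (two k≤m m≤) (two k≤l l≤)
  where
  two : ∀ {k m} → k ℕ.≤ m → m ℕ.≤ suc k → m ≡ k ⊎ m ≡ suc k
  two k≤m m≤ with ℕ.m≤n⇒m<n∨m≡n m≤
  ... | inj₁ (s≤s m≤k) = inj₁ (ℕ.≤-antisym m≤k k≤m)
  ... | inj₂ e         = inj₂ e
  go : ∀ c {k m l} → m ≡ k ⊎ m ≡ suc k → l ≡ k ⊎ l ≡ suc k →
       ∃[ v ] ∃[ c′ ] Plaq c (+ k) (+ m) (+ l) (+ v) c′
  go zero    (inj₁ refl) (inj₁ refl) = _ , _ , idle
  go (suc c) (inj₁ refl) (inj₁ refl) = _ , _ , drop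
  go c       (inj₁ refl) (inj₂ refl) = _ , _ , pass₂
  go c       (inj₂ refl) (inj₁ refl) = _ , _ , pass₁
  go c       (inj₂ refl) (inj₂ refl) = _ , _ , take

module FaceProperties {ℓ : ℕ} {κ μ lam ν : Signature ℓ} (F : Face κ μ lam ν) where

  private
    c : ℤ → ℕ
    c = Face.carrier F
    P : ∀ x → Plaq (c (ℤ.pred x)) (+ conj κ x) (+ conj μ x) (+ conj lam x) (+ conj ν x) (c x)
    P = Face.plaquette F

  face-κ⪯μ : κ ⪯ μ
  face-κ⪯μ = conj⇒⪯ (λ x → ℤ.drop‿+≤+ (plaq-l≤l₁ (P x)))
    (λ x → ℤ.drop‿+≤+ (ℤ.≤-trans (plaq-l₁≤l₁₂ (P x)) (plaq-l₁₂≤suc-l (P x))))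

  face-μ⪯ν : μ ⪯ ν
  face-μ⪯ν = conj⇒⪯ (λ x → ℤ.drop‿+≤+ (plaq-l₁≤l₁₂ (P x)))
    (λ x → ℤ.drop‿+≤+ (ℤ.≤-trans (plaq-l₁₂≤suc-l (P x)) (ℤ.suc-mono (plaq-l≤l₁ (P x)))))

  face-swap : Face κ lam μ ν
  face-swap = face c λ x → plaq-swap (P x)

  -- Far to the left every row of κ and of ν is present, so the face is `idle` there and the carrier
  -- is empty. From there on both sides obey the same recursion.
  face-load : κ ⪯ μ → κ ⪯ lam → ∀ x → c x ≡ load κ μ lam x
  face-load κ⪯μ κ⪯lam
    with a , full ← conj-full κ | b , full′ ← conj-full ν =
    ℤ-ascend _ (a ℤ.⊓ b ℤ.⊓ bottom κ) base step
    where
    base : ∀ x → x ℤ.≤ a ℤ.⊓ b ℤ.⊓ bottom κ → c x ≡ load κ μ lam x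
    base x x≤ = trans
      (proj₂ (plaq-idle (P x) (ℤ.≤-reflexive (cong +_
        (trans (full′ x (ℤ.≤-trans x≤ab (ℤ.i⊓j≤j a b)))
               (sym (full x (ℤ.≤-trans x≤ab (ℤ.i⊓j≤i a b)))))))))
      (sym (load-vanishes κ μ lam x (ℤ.≤-trans x≤ (ℤ.i⊓j≤j (a ℤ.⊓ b) (bottom κ)))))
      where
      x≤ab : x ℤ.≤ a ℤ.⊓ b
      x≤ab = ℤ.≤-trans x≤ (ℤ.i⊓j≤i (a ℤ.⊓ b) (bottom κ))
    step : ∀ x → c (ℤ.pred x) ≡ load κ μ lam (ℤ.pred x) → c x ≡ load κ μ lam x
    step x e = trans (plaq-load (P x))
      (trans (cong (λ z → (added κ μ x ℕ.+ added κ lam x ℕ.+ z) ∸ 1) e)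
             (sym (load-rec κ⪯μ κ⪯lam x)))

open FaceProperties using (face-κ⪯μ; face-μ⪯ν; face-swap; face-load)

face-κ⪯lam : ∀ {ℓ} {κ μ lam ν : Signature ℓ} → Face κ μ lam ν → κ ⪯ lam
face-κ⪯lam F = face-κ⪯μ (face-swap F)

face-lam⪯ν : ∀ {ℓ} {κ μ lam ν : Signature ℓ} → Face κ μ lam ν → lam ⪯ ν
face-lam⪯ν F = face-μ⪯ν (face-swap F)

face⇒IsF̄ : ∀ {ℓ} {κ μ lam ν : Signature ℓ} → Face κ μ lam ν → IsF̄ κ μ lam ν
face⇒IsF̄ {κ = κ} {μ} {lam} F@(face c P) = record { conj-eq = λ x →
  trans (plaq-balance (P x))
    (cong₂ (λ u v → + conj μ x ℤ.+ + conj lam x ℤ.- + conj κ x ℤ.+ + u ℤ.- + v)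
           (c≡load (ℤ.pred x)) (c≡load x)) }
  where
  c≡load : ∀ x → c x ≡ load κ μ lam x
  c≡load = face-load F (face-κ⪯μ F) (face-κ⪯lam F)

module Growth {ℓ : ℕ} {κ μ lam : Signature ℓ} (κ⪯μ : κ ⪯ μ) (κ⪯lam : κ ⪯ lam) where

  private
    c : ℤ → ℕ
    c = load κ μ lam

    new : ∀ x → ∃[ v ] Plaq (c (ℤ.pred x)) (+ conj κ x) (+ conj μ x) (+ conj lam x) (+ v) (c x)
    new x with v , c′ , P ← plaq-exists (c (ℤ.pred x))
                (⪯⇒conj-≤ κ⪯μ x) (⪯⇒conj-≤-suc κ⪯μ x) (⪯⇒conj-≤ κ⪯lam x) (⪯⇒conj-≤-suc κ⪯lam x) =
      v , plaq-≡ refl refl refl refl refl (trans (plaq-load P) (sym (load-rec κ⪯μ κ⪯lam x))) P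

  -- `new` fixes a plaquette in each column from κ, μ, λ and the load; its last length and ν′ₓ solve
  -- the same balance equation.
  IsF̄⇒face : ∀ {ν} → IsF̄ κ μ lam ν → Face κ μ lam ν
  IsF̄⇒face F = face c λ x → let v , P = new x in
    plaq-≡ refl refl refl refl (trans (plaq-balance P) (sym (IsF̄.conj-eq F x))) refl P

  -- To the right of all parts of μ and λ the carrier only unloads.
  load-empties : ∃[ b ] ∀ x → b ℤ.≤ x →
                 conj κ x ≡ 0 × conj μ x ≡ 0 × conj lam x ≡ 0 × c (ℤ.pred x) ≡ 0
  load-empties with b₁ , e₁ ← conj-empty μ | b₂ , e₂ ← conj-empty lam =
    -- From column b on one unit is lost per column, so `c b` further columns suffice. The `ℤ.suc`
    -- is there because the claim concerns the load entering column x.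
    ℤ.suc (b ℤ.+ + c b) , λ x h →
      let h′ = ℤ.≤-trans (ℤ.≤-trans (ℤ.i≤i+j b (+ c b)) (ℤ.i≤suc[i] _)) h
      in κ-empty x h′ , μ-empty x h′ , lam-empty x h′ , c-empty (ℤ.pred x) (suc≤⇒≤pred h)
    where
    b : ℤ
    b = b₁ ℤ.⊔ b₂
    μ-empty : ∀ x → b ℤ.≤ x → conj μ x ≡ 0
    μ-empty x h = e₁ x (ℤ.≤-trans (ℤ.i≤i⊔j b₁ b₂) h)
    lam-empty : ∀ x → b ℤ.≤ x → conj lam x ≡ 0
    lam-empty x h = e₂ x (ℤ.≤-trans (ℤ.i≤j⊔i b₁ b₂) h)
    κ-empty : ∀ x → b ℤ.≤ x → conj κ x ≡ 0
    κ-empty x h = ℕ.n≤0⇒n≡0 (subst (conj κ x ℕ.≤_) (μ-empty x h) (⪯⇒conj-≤ κ⪯μ x))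
    unload : ∀ j → c (b ℤ.+ + j) ≡ c b ∸ j
    unload zero    = cong c (ℤ.+-identityʳ b)
    unload (suc j) = trans (load-rec κ⪯μ κ⪯lam x)
      (trans (cong₂ (λ u v → (u ∸ conj κ x ℕ.+ (v ∸ conj κ x) ℕ.+ c (ℤ.pred x)) ∸ 1)
                    (μ-empty x b≤x) (lam-empty x b≤x))
      (trans (cong₂ (λ u v → (u ℕ.+ u ℕ.+ c v) ∸ 1) (ℕ.0∸n≡0 (conj κ x)) (eq b (+ j)))
      (trans (cong (_∸ 1) (unload j)) (trans (ℕ.∸-+-assoc (c b) j 1) (cong (c b ∸_) (ℕ.+-comm j 1))))))
      where
      x : ℤ
      x = b ℤ.+ + suc j
      b≤x : b ℤ.≤ x
      b≤x = ℤ.i≤i+j b (+ suc j)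
      eq : ∀ b j → -1ℤ ℤ.+ (b ℤ.+ (1ℤ ℤ.+ j)) ≡ b ℤ.+ j
      eq = solve-∀
    c-empty : ∀ x → b ℤ.+ + c b ℤ.≤ x → c x ≡ 0
    c-empty x h = trans (cong c (sym x≡)) (trans (unload j)
                    (ℕ.m≤n⇒m∸n≡0 (ℤ.drop‿+≤+ (subst (+ c b ℤ.≤_) (sym +j≡) c≤x-b))))
      where
      j : ℕ
      j = ℤ.∣ x ℤ.- b ∣
      eq : ∀ b c → (b ℤ.+ c) ℤ.- b ≡ c
      eq = solve-∀
      eq′ : ∀ b x → b ℤ.+ (x ℤ.- b) ≡ x
      eq′ = solve-∀
      c≤x-b : + c b ℤ.≤ x ℤ.- b
      c≤x-b = subst (ℤ._≤ x ℤ.- b) (eq b (+ c b)) (ℤ.+-monoˡ-≤ (ℤ.- b) h)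
      +j≡ : + j ≡ x ℤ.- b
      +j≡ = ℤ.0≤i⇒+∣i∣≡i (ℤ.≤-trans (ℤ.+≤+ z≤n) c≤x-b)
      x≡ : b ℤ.+ + j ≡ x
      x≡ = trans (cong (λ z → b ℤ.+ z) +j≡) (eq′ b x)

  opaque
    -- The lengths `v` found column by column form a conjugate: adjacent ones are ordered by
    -- `plaq-compare`, on the left nothing has been added yet, and on the right the carrier has run
    -- empty.
    grow : ∃[ ν ] Face κ μ lam ν
    grow with a , full ← conj-full κ | b , empties ← load-empties =
      fromConj v antitone a′ b v-full v-empty , face c λ x →
        plaq-≡ refl refl refl refl
               (cong +_ (sym (conj-fromConj v antitone a′ b v-full v-empty x))) refl (proj₂ (new x))
      where
      v : ℤ → ℕ
      v x = proj₁ (new x)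
      a′ : ℤ
      a′ = a ℤ.⊓ bottom κ
      antitone : ∀ x → v x ℕ.≤ v (ℤ.pred x)
      antitone x = ℤ.drop‿+≤+ (plaq-compare (proj₂ (new (ℤ.pred x))) (proj₂ (new x))
        (ℤ.+≤+ (conj-antitone κ x-1≤x)) (ℤ.+≤+ (conj-antitone μ x-1≤x))
        (ℤ.+≤+ (conj-antitone lam x-1≤x)))
        where
        x-1≤x : ℤ.pred x ℤ.≤ x
        x-1≤x = ℤ.i≤j⇒pred[i]≤j ℤ.≤-refl
      same : ∀ x {k} → conj κ x ≡ k → conj μ x ≡ k → conj lam x ≡ k → c (ℤ.pred x) ≡ 0 → v x ≡ k
      same x eκ eμ elam ec = trans (ℤ.+-injective (proj₂ (plaq-flat (proj₂ (new x))
        (cong +_ (trans eμ (sym eκ))) (cong +_ (trans elam (sym eκ)))) ec)) eκ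
      v-full : ∀ x → x ℤ.≤ a′ → v x ≡ ℓ
      v-full x x≤ = same x κ-full (above κ⪯μ) (above κ⪯lam)
        (load-vanishes κ μ lam (ℤ.pred x)
          (ℤ.i≤j⇒pred[i]≤j (ℤ.≤-trans x≤ (ℤ.i⊓j≤j a (bottom κ)))))
        where
        κ-full : conj κ x ≡ ℓ
        κ-full = full x (ℤ.≤-trans x≤ (ℤ.i⊓j≤i a (bottom κ)))
        above : ∀ {ν} → κ ⪯ ν → conj ν x ≡ ℓ
        above {ν} h = ℕ.≤-antisym (conj≤ℓ ν x) (subst (ℕ._≤ conj ν x) κ-full (⪯⇒conj-≤ h x))
      v-empty : ∀ x → b ℤ.≤ x → v x ≡ 0
      v-empty x h with eκ , eμ , elam , ec ← empties x h = same x eκ eμ elam ec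

open Growth using (IsF̄⇒face; grow)

face-det : ∀ {ℓ} {κ μ lam ν ν′ : Signature ℓ} → Face κ μ lam ν → Face κ μ lam ν′ → ν ≡ ν′
face-det F@(face c P) F′@(face c′ P′) = conj-injective λ x → ℤ.+-injective
  (proj₁ (plaq-det (P x) (P′ x) (c≡c′ (ℤ.pred x)) refl refl refl))
  where
  c≡c′ : ∀ x → c x ≡ c′ x
  c≡c′ x = trans (face-load F (face-κ⪯μ F) (face-κ⪯lam F) x)
                 (sym (face-load F′ (face-κ⪯μ F) (face-κ⪯lam F) x))

-- Negation of signatures and the half turn of a face

module Flip {ℓ : ℕ} (κ : Signature ℓ) where

  private
    f : ℤ → ℕ
    -- The inequality - κⱼ ≥ x fails exactly when κⱼ ≥ 1 - x.
    f x = ℓ ∸ conj κ (1ℤ ℤ.- x)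

    1-pred : ∀ x → 1ℤ ℤ.- x ℤ.≤ 1ℤ ℤ.- ℤ.pred x
    1-pred x = ℤ.+-monoʳ-≤ 1ℤ (ℤ.neg-mono-≤ {ℤ.pred x} {x} (ℤ.i≤j⇒pred[i]≤j ℤ.≤-refl))

    1-swap : ∀ x → 1ℤ ℤ.- (1ℤ ℤ.- x) ≡ x
    1-swap = eq
      where
      eq : ∀ x → 1ℤ ℤ.- (1ℤ ℤ.- x) ≡ x
      eq = solve-∀

    f-antitone : ∀ x → f x ℕ.≤ f (ℤ.pred x)
    f-antitone x = ℕ.∸-monoʳ-≤ ℓ (conj-antitone κ (1-pred x))

    f-full : ∀ x → x ℤ.≤ 1ℤ ℤ.- proj₁ (conj-empty κ) → f x ≡ ℓ
    f-full x h = cong (ℓ ∸_) (proj₂ (conj-empty κ) (1ℤ ℤ.- x)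
      (subst (ℤ._≤ 1ℤ ℤ.- x) (1-swap _) (ℤ.+-monoʳ-≤ 1ℤ (ℤ.neg-mono-≤ h))))

    f-empty : ∀ x → 1ℤ ℤ.- proj₁ (conj-full κ) ℤ.≤ x → f x ≡ 0
    f-empty x h = trans (cong (ℓ ∸_) (proj₂ (conj-full κ) (1ℤ ℤ.- x)
      (subst (1ℤ ℤ.- x ℤ.≤_) (1-swap _) (ℤ.+-monoʳ-≤ 1ℤ (ℤ.neg-mono-≤ h))))) (ℕ.n∸n≡0 ℓ)

  -- The signature (- κ_ℓ , ... , - κ_1).
  opaque
    flip : Signature ℓ
    flip = fromConj f f-antitone _ _ f-full f-empty

    conj-flip : ∀ x → conj flip x ≡ ℓ ∸ conj κ (1ℤ ℤ.- x)
    conj-flip = conj-fromConj f f-antitone _ _ f-full f-empty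

  +conj-flip : ∀ x → + conj flip x ≡ ℤ.- + conj κ (1ℤ ℤ.- x) ℤ.+ + ℓ
  +conj-flip x = trans (cong +_ (conj-flip x)) (trans (sym (ℤ.⊖-≥ (conj≤ℓ κ (1ℤ ℤ.- x))))
    (trans (sym (ℤ.m-n≡m⊖n ℓ (conj κ (1ℤ ℤ.- x)))) (ℤ.+-comm (+ ℓ) (ℤ.- + conj κ (1ℤ ℤ.- x)))))

  flip-swap : ∀ x → ℓ ∸ (ℓ ∸ conj κ (1ℤ ℤ.- (1ℤ ℤ.- x))) ≡ conj κ x
  flip-swap x = trans (cong (λ z → ℓ ∸ (ℓ ∸ conj κ z)) (1-swap x)) (ℕ.m∸[m∸n]≡n (conj≤ℓ κ x))

open Flip using (flip; conj-flip; +conj-flip; flip-swap)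

flip-involutive : ∀ {ℓ} (κ : Signature ℓ) → flip (flip κ) ≡ κ
flip-involutive {ℓ} κ = conj-injective λ x → trans (conj-flip (flip κ) x)
  (trans (cong (ℓ ∸_) (conj-flip κ (1ℤ ℤ.- x))) (flip-swap κ x))

flip-⪯ : ∀ {ℓ} {κ μ : Signature ℓ} → κ ⪯ μ → flip μ ⪯ flip κ
flip-⪯ {ℓ} {κ} {μ} h = conj⇒⪯
  (λ x → subst₂ ℕ._≤_ (sym (conj-flip μ x)) (sym (conj-flip κ x))
    (ℕ.∸-monoʳ-≤ ℓ (⪯⇒conj-≤ h (1ℤ ℤ.- x))))
  (λ x → subst₂ ℕ._≤_ (sym (conj-flip κ x)) (cong suc (sym (conj-flip μ x)))
    (∸-suc (conj κ (1ℤ ℤ.- x)) (conj μ (1ℤ ℤ.- x)) (⪯⇒conj-≤-suc h (1ℤ ℤ.- x))))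
  where
  ∸-suc : ∀ k m → m ℕ.≤ suc k → ℓ ∸ k ℕ.≤ suc (ℓ ∸ m)
  ∸-suc k m m≤ = ℕ.m≤n+o⇒m∸n≤o ℓ k (ℕ.≤-trans (ℕ.m≤n+m∸n ℓ m)
    (ℕ.≤-trans (ℕ.+-monoˡ-≤ (ℓ ∸ m) m≤) (ℕ.≤-reflexive (sym (ℕ.+-suc k (ℓ ∸ m))))))

-- Column x of the new face is the reflected column 1 - x, raised by ℓ. The load leaving it is the
-- one that entered column 1 - x, namely c at - x. This makes the inverse local rule an instance of
-- the local rule.
face-flip : ∀ {ℓ} {κ μ lam ν : Signature ℓ} → Face κ μ lam ν →
            Face (flip ν) (flip lam) (flip μ) (flip κ)
face-flip {ℓ} {κ} {μ} {lam} {ν} (face c P) = face (λ x → c (ℤ.- x)) λ x →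
  plaq-≡ (cong c (eq₁ x)) (sym (+conj-flip ν x)) (sym (+conj-flip lam x))
         (sym (+conj-flip μ x)) (sym (+conj-flip κ x)) (cong c (eq₂ x))
         (plaq-shift (+ ℓ) (plaq-reflect (P (1ℤ ℤ.- x))))
  where
  eq₁ : ∀ x → 1ℤ ℤ.- x ≡ ℤ.- (-1ℤ ℤ.+ x)
  eq₁ = solve-∀
  eq₂ : ∀ x → -1ℤ ℤ.+ (1ℤ ℤ.- x) ≡ ℤ.- x
  eq₂ = solve-∀

-- The field with given boundary

-- Chains are infinite, so that growing needs no bounds; only the terms up to n matter for a square.
record Chain (ℓ : ℕ) : Set where
  field
    term : ℕ → Signature ℓ
    link : ∀ i → term i ⪯ term (suc i)

open Chain

module _ {ℓ : ℕ} (b : Chain ℓ) {a : Signature ℓ} (h : term b 0 ⪯ a) where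

  -- The line above `b` grows from left to right: the right side of each face is the left side of
  -- the next.
  push-cell : ∀ i → ∃[ v ] term b i ⪯ v
  push-cell zero    = a , h
  push-cell (suc i) with ν , F ← grow (link b i) (proj₂ (push-cell i)) = ν , face-μ⪯ν F

  push-face : ∀ i → Face (term b i) (term b (suc i)) (proj₁ (push-cell i)) (proj₁ (push-cell (suc i)))
  push-face i = proj₂ (grow (link b i) (proj₂ (push-cell i)))

  push : Chain ℓ
  push = record { term = λ i → proj₁ (push-cell i) ; link = λ i → face-lam⪯ν (push-face i) }

module _ {ℓ : ℕ} {κ κ′ μ μ′ lam lam′ ν ν′ : Signature ℓ} where

  face-≡ : κ ≡ κ′ → μ ≡ μ′ → lam ≡ lam′ → ν ≡ ν′ → Face κ μ lam ν → Face κ′ μ′ lam′ ν′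
  face-≡ refl refl refl refl F = F

  face-det-≡ : Face κ μ lam ν → Face κ′ μ′ lam′ ν′ → κ ≡ κ′ → μ ≡ μ′ → lam ≡ lam′ → ν ≡ ν′
  face-det-≡ F F′ refl refl refl = face-det F F′

Faces : ∀ {ℓ} → ℕ → (ℕ → ℕ → Signature ℓ) → Set
Faces n g = ∀ i j → i ℕ.< n → j ℕ.< n →
            Face (g i j) (g (suc i) j) (g i (suc j)) (g (suc i) (suc j))

Agree : ∀ {ℓ} → ℕ → (g h : ℕ → ℕ → Signature ℓ) → Set
Agree n g h = ∀ i j → i ℕ.≤ n → j ℕ.≤ n → g i j ≡ h i j

faces-unique : ∀ {ℓ n} {g h : ℕ → ℕ → Signature ℓ} → Faces n g → Faces n h →
               (∀ i → i ℕ.≤ n → g i 0 ≡ h i 0) → (∀ j → j ℕ.≤ n → g 0 j ≡ h 0 j) → Agree n g h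
faces-unique F F′ bot left i       zero    i≤n j≤n = bot i i≤n
faces-unique F F′ bot left zero    (suc j) i≤n j≤n = left (suc j) j≤n
faces-unique F F′ bot left (suc i) (suc j) i<n j<n =
  face-det-≡ (F i j i<n j<n) (F′ i j i<n j<n)
    (faces-unique F F′ bot left i j (ℕ.<⇒≤ i<n) (ℕ.<⇒≤ j<n))
    (faces-unique F F′ bot left (suc i) j i<n (ℕ.<⇒≤ j<n))
    (faces-unique F F′ bot left i (suc j) (ℕ.<⇒≤ i<n) j<n)

∸-suc : ∀ {n i} → i ℕ.< n → suc (n ∸ suc i) ≡ n ∸ i
∸-suc {n} i<n = sym (ℕ.+-∸-assoc 1 i<n)

turn : ∀ {ℓ} → ℕ → (ℕ → ℕ → Signature ℓ) → ℕ → ℕ → Signature ℓ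
turn n g i j = flip (g (n ∸ i) (n ∸ j))

turn-involutive : ∀ {ℓ n} (g : ℕ → ℕ → Signature ℓ) → Agree n (turn n (turn n g)) g
turn-involutive {n = n} g i j i≤n j≤n =
  trans (flip-involutive _) (cong₂ g (ℕ.m∸[m∸n]≡n i≤n) (ℕ.m∸[m∸n]≡n j≤n))

turn-faces : ∀ {ℓ n} {g : ℕ → ℕ → Signature ℓ} → Faces n g → Faces n (turn n g)
turn-faces {n = n} {g} F i j i<n j<n =
  face-≡ (at-≡ (∸-suc i<n) (∸-suc j<n)) (at-≡ refl (∸-suc j<n)) (at-≡ (∸-suc i<n) refl) refl
    (face-flip (F (n ∸ suc i) (n ∸ suc j) (lower i<n) (lower j<n)))
  where
  at-≡ : ∀ {i i′ j j′} → i ≡ i′ → j ≡ j′ → flip (g i j) ≡ flip (g i′ j′)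
  at-≡ refl refl = refl
  lower : ∀ {i} → i ℕ.< n → n ∸ suc i ℕ.< n
  lower {i} i<n = subst (ℕ._≤ n) (sym (∸-suc i<n)) (ℕ.m∸n≤m n i)

-- A half turn makes the top and right sides the bottom and left ones, where `faces-unique` applies.
faces-unique-back : ∀ {ℓ n} {g h : ℕ → ℕ → Signature ℓ} → Faces n g → Faces n h →
  (∀ i → i ℕ.≤ n → g i n ≡ h i n) → (∀ j → j ℕ.≤ n → g n j ≡ h n j) → Agree n g h
faces-unique-back {n = n} {g} {h} F F′ top right i j i≤n j≤n =
  trans (sym (turn-involutive g i j i≤n j≤n)) (trans
    (cong flip (faces-unique (turn-faces F) (turn-faces F′)
      (λ i _ → cong flip (top (n ∸ i) (ℕ.m∸n≤m n i)))
      (λ j _ → cong flip (right (n ∸ j) (ℕ.m∸n≤m n j)))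
      (n ∸ i) (n ∸ j) (ℕ.m∸n≤m n i) (ℕ.m∸n≤m n j)))
    (turn-involutive h i j i≤n j≤n))

-- Block t stands for the square [0, n] × [tn, (t + 1)n]; its right side is
-- identified with the left side of block t + 1 on the cylinder.
record Blocks (n ℓ : ℕ) : Set where
  field
    block : ℤ → ℕ → ℕ → Signature ℓ
    top   : ∀ t i → i ℕ.≤ n → block t i n ≡ block (ℤ.suc t) i 0
    right : ∀ t j → j ℕ.≤ n → block t n j ≡ block (ℤ.suc t) 0 j
    faces : ∀ t → Faces n (block t)

open Blocks

blocks-unique : ∀ {n ℓ} (X Y : Blocks n ℓ) →
                (∀ i → i ℕ.≤ n → block X 0ℤ i 0 ≡ block Y 0ℤ i 0) →
                (∀ j → j ℕ.≤ n → block X 0ℤ 0 j ≡ block Y 0ℤ 0 j) →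
                ∀ t → Agree n (block X t) (block Y t)
blocks-unique {n} X Y bot left = ℤ-bidirectional Same
  (faces-unique (faces X 0ℤ) (faces Y 0ℤ) bot left)
  (λ t same → subst Same (ℤ.suc-pred t) (up (ℤ.pred t) same))
  (λ t same → down (ℤ.pred t) (subst Same (sym (ℤ.suc-pred t)) same))
  where
  Same : ℤ → Set
  Same t = Agree n (block X t) (block Y t)
  up : ∀ t → Same t → Same (ℤ.suc t)
  up t same = faces-unique (faces X _) (faces Y _)
    (λ i i≤n → trans (sym (top X t i i≤n)) (trans (same i n i≤n ℕ.≤-refl) (top Y t i i≤n)))
    (λ j j≤n → trans (sym (right X t j j≤n)) (trans (same n j ℕ.≤-refl j≤n) (right Y t j j≤n)))
  down : ∀ t → Same (ℤ.suc t) → Same t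
  down t same = faces-unique-back (faces X _) (faces Y _)
    (λ i i≤n → trans (top X t i i≤n) (trans (same i 0 i≤n z≤n) (sym (top Y t i i≤n))))
    (λ j j≤n → trans (right X t j j≤n) (trans (same 0 j z≤n j≤n) (sym (right Y t j j≤n))))

-- `closing` is the identification (n , 0) ~ (0 , n) on the cylinder. It makes the top and right
-- sides of the filled square start at the same signature, so that they form the next frame.
record Frame (n ℓ : ℕ) : Set where
  field
    bot left : Chain ℓ
    corner   : term bot 0 ≡ term left 0
    closing  : term bot n ≡ term left n

open Frame

module _ {n ℓ : ℕ} (S : Frame n ℓ) where

  lines : ∀ j → Σ[ L ∈ Chain ℓ ] term L 0 ≡ term (left S) j
  lines zero    = bot S , corner S
  lines (suc j) = push (proj₁ (lines j)) (subst (_⪯ _) (sym (proj₂ (lines j))) (link (left S) j)) , refl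

  fill : ℕ → ℕ → Signature ℓ
  fill i j = term (proj₁ (lines j)) i

  fill-face : ∀ i j → Face (fill i j) (fill (suc i) j) (fill i (suc j)) (fill (suc i) (suc j))
  fill-face i j = push-face (proj₁ (lines j)) (subst (_⪯ _) (sym (proj₂ (lines j))) (link (left S) j)) i

  next : Frame n ℓ
  next = record
    { bot     = proj₁ (lines n)
    ; left    = record { term = fill n ; link = λ j → face-κ⪯lam (fill-face n j) }
    ; corner  = trans (proj₂ (lines n)) (sym (closing S))
    ; closing = refl
    }

turn-chain : ∀ {ℓ} → ℕ → Chain ℓ → Chain ℓ
turn-chain n b = record { term = λ i → flip (term b (n ∸ i)) ; link = λ i → flip-⪯ (linked i) }
  where
  linked : ∀ i → term b (n ∸ suc i) ⪯ term b (n ∸ i)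
  linked i with i ℕ.<? n
  ... | yes i<n = subst (λ k → term b (n ∸ suc i) ⪯ term b k) (∸-suc i<n) (link b (n ∸ suc i))
  ... | no  i≮n rewrite ℕ.m≤n⇒m∸n≡0 (ℕ.≮⇒≥ i≮n)
                      | ℕ.m≤n⇒m∸n≡0 (ℕ.m≤n⇒m≤1+n (ℕ.≮⇒≥ i≮n)) = ⪯-refl

turn-frame : ∀ {n ℓ} → Frame n ℓ → Frame n ℓ
turn-frame {n} S = record
  { bot     = turn-chain n (bot S)
  ; left    = turn-chain n (left S)
  ; corner  = cong flip (closing S)
  ; closing = cong flip (trans (cong (term (bot S)) (ℕ.n∸n≡0 n))
                (trans (corner S) (cong (term (left S)) (sym (ℕ.n∸n≡0 n)))))
  }

frames : ∀ {n ℓ} → Frame n ℓ → ℕ → Frame n ℓ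
frames S zero    = S
frames S (suc t) = next (frames S t)

-- Going back is going forward after a half turn: the turned frame is filled forward and each of its
-- squares is turned back. The two halves meet along `S` because `flip` is an involution.
frame-blocks : ∀ {n ℓ} → Frame n ℓ → Blocks n ℓ
frame-blocks {n} {ℓ} S = record { block = G ; top = G-top ; right = G-right ; faces = G-faces }
  where
  fwd bwd : ℕ → Frame n ℓ
  fwd = frames S
  bwd = frames (turn-frame S)
  G : ℤ → ℕ → ℕ → Signature ℓ
  G (+ t)    = fill (fwd t)
  G -[1+ t ] = turn n (fill (bwd t))
  G-faces : ∀ t → Faces n (G t)
  G-faces (+ t)    = λ i j _ _ → fill-face (fwd t) i j
  G-faces -[1+ t ] = turn-faces (λ i j _ _ → fill-face (bwd t) i j)
  G-top : ∀ t i → i ℕ.≤ n → G t i n ≡ G (ℤ.suc t) i 0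
  G-top (+ t)          i i≤n = refl
  G-top -[1+ zero ]    i i≤n = trans (cong (λ k → flip (fill (bwd 0) (n ∸ i) k)) (ℕ.n∸n≡0 n))
    (trans (flip-involutive _) (cong (term (bot S)) (ℕ.m∸[m∸n]≡n i≤n)))
  G-top -[1+ suc t ]   i i≤n = cong (λ k → flip (fill (bwd (suc t)) (n ∸ i) k)) (ℕ.n∸n≡0 n)
  G-right : ∀ t j → j ℕ.≤ n → G t n j ≡ G (ℤ.suc t) 0 j
  G-right (+ t)        j j≤n = sym (proj₂ (lines (fwd (suc t)) j))
  G-right -[1+ zero ]  j j≤n = trans (cong (λ k → flip (fill (bwd 0) k (n ∸ j))) (ℕ.n∸n≡0 n))
    (trans (cong flip (proj₂ (lines (bwd 0) (n ∸ j))))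
    (trans (flip-involutive _)
    (trans (cong (term (left S)) (ℕ.m∸[m∸n]≡n j≤n)) (sym (proj₂ (lines S j))))))
  G-right -[1+ suc t ] j j≤n = cong flip (trans (cong (λ k → fill (bwd (suc t)) k (n ∸ j)) (ℕ.n∸n≡0 n))
    (proj₂ (lines (bwd (suc t)) (n ∸ j))))

private
  suc-* : ∀ k n → (1ℤ ℤ.+ k) ℤ.* n ≡ n ℤ.+ k ℤ.* n
  suc-* = solve-∀

divMod-≮ : ∀ {n i i′} k k′ → i ℕ.< n → + i ℤ.+ k ℤ.* + n ≡ + i′ ℤ.+ k′ ℤ.* + n → ¬ k ℤ.< k′
divMod-≮ {n} {i} {i′} k k′ i<n e k<k′ = ℕ.<⇒≱ i<n (ℤ.drop‿+≤+
  (subst₂ ℤ._≤_ (eq (+ n) (k ℤ.* + n)) (eq (+ i) (k ℤ.* + n))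
  (ℤ.+-monoˡ-≤ (ℤ.- (k ℤ.* + n)) n+kn≤i+kn)))
  where
  eq : ∀ a b → (a ℤ.+ b) ℤ.- b ≡ a
  eq = solve-∀
  n+kn≤i+kn : + n ℤ.+ k ℤ.* + n ℤ.≤ + i ℤ.+ k ℤ.* + n
  n+kn≤i+kn = subst₂ ℤ._≤_ (suc-* k (+ n)) (sym e)
    (ℤ.≤-trans (ℤ.*-monoʳ-≤-nonNeg (+ n) (ℤ.i<j⇒suc[i]≤j k<k′)) (ℤ.i≤j+i (k′ ℤ.* + n) (+ i′)))

divMod-unique : ∀ {n i i′} k k′ → i ℕ.< n → i′ ℕ.< n →
                + i ℤ.+ k ℤ.* + n ≡ + i′ ℤ.+ k′ ℤ.* + n → i ≡ i′ × k ≡ k′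
divMod-unique k k′ i<n i′<n e with ℤ.<-cmp k k′
... | tri< k<k′ _ _ = contradiction k<k′ (divMod-≮ k k′ i<n e)
... | tri> _ _ k′<k = contradiction k′<k (divMod-≮ k′ k i′<n (sym e))
... | tri≈ _ refl _ = ℤ.+-injective (+-cancelʳ (k ℤ.* + _) (+ _) (+ _) e) , refl

-- The position of p = (x , y) in the block decomposition of the cylinder.
record Position (n : ℕ) (p : Point) : Set where
  constructor position
  field
    k t : ℤ
    i j : ℕ
    i<n : i ℕ.< n
    j<n : j ℕ.< n
    x≡  : proj₁ p ≡ + i ℤ.+ k ℤ.* + n
    y≡  : proj₂ p ℤ.+ k ℤ.* + n ≡ + j ℤ.+ t ℤ.* + n

-- Translation by - k brings x into [0 , n) and moves y to y + kn, whose quotient by n is the block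
-- number.
locate : ∀ n .{{_ : ℕ.NonZero n}} p → Position n p
locate n (x , y) = position k (y′ ℤ./ℕ n) (x ℤ.%ℕ n) (y′ ℤ.%ℕ n)
  (ℤ.n%ℕd<d x n) (ℤ.n%ℕd<d y′ n) (ℤ.a≡a%ℕn+[a/ℕn]*n x n) (ℤ.a≡a%ℕn+[a/ℕn]*n y′ n)
  where
  k y′ : ℤ
  k  = x ℤ./ℕ n
  y′ = y ℤ.+ k ℤ.* + n

module _ {n ℓ : ℕ} .{{_ : ℕ.NonZero n}} (X : Blocks n ℓ) where

  glue : Point → Signature ℓ
  glue p = block X (Position.t P) (Position.i P) (Position.j P)
    where P = locate n p

  private
    0<n : 0 ℕ.< n
    0<n = ℕ.>-nonZero⁻¹ n

    carry : ∀ k → + n ℤ.+ k ℤ.* + n ≡ 0ℤ ℤ.+ ℤ.suc k ℤ.* + n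
    carry k = trans (sym (suc-* k (+ n))) (sym (ℤ.+-identityˡ _))

    glue-<< : ∀ x y i j k t → i ℕ.< n → j ℕ.< n → x ≡ + i ℤ.+ k ℤ.* + n →
              y ℤ.+ k ℤ.* + n ≡ + j ℤ.+ t ℤ.* + n → glue (x , y) ≡ block X t i j
    glue-<< x y i j k t i<n j<n ex ey = go (locate n (x , y))
      where
      go : (P : Position n (x , y)) →
           block X (Position.t P) (Position.i P) (Position.j P) ≡ block X t i j
      go (position k′ t′ i′ j′ i′<n j′<n ex′ ey′)
        with refl , refl ← divMod-unique k′ k i′<n i<n (trans (sym ex′) ex)
        with refl , refl ← divMod-unique t′ t j′<n j<n (trans (sym ey′) ey) = refl

    glue-<≤ : ∀ x y i j k t → i ℕ.< n → j ℕ.≤ n → x ≡ + i ℤ.+ k ℤ.* + n →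
              y ℤ.+ k ℤ.* + n ≡ + j ℤ.+ t ℤ.* + n → glue (x , y) ≡ block X t i j
    glue-<≤ x y i j k t i<n j≤n ex ey with ℕ.m≤n⇒m<n∨m≡n j≤n
    ... | inj₁ j<n  = glue-<< x y i j k t i<n j<n ex ey
    ... | inj₂ refl = trans (glue-<< x y i 0 k (ℤ.suc t) i<n 0<n ex (trans ey (carry t)))
                            (sym (top X t i (ℕ.<⇒≤ i<n)))

  -- `locate` never returns i = n or j = n. Such a point belongs to the next block, and `top` and
  -- `right` identify the values, so each face can be checked inside one closed square.
  glue-block : ∀ x y i j k t → i ℕ.≤ n → j ℕ.≤ n → x ≡ + i ℤ.+ k ℤ.* + n →
               y ℤ.+ k ℤ.* + n ≡ + j ℤ.+ t ℤ.* + n → glue (x , y) ≡ block X t i j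
  glue-block x y i j k t i≤n j≤n ex ey with ℕ.m≤n⇒m<n∨m≡n i≤n
  ... | inj₁ i<n  = glue-<≤ x y i j k t i<n j≤n ex ey
  ... | inj₂ refl = trans (glue-<≤ x y 0 j (ℤ.suc k) (ℤ.suc t) 0<n j≤n (trans ex (carry k)) ey′)
                          (sym (right X t j j≤n))
    where
    eq : ∀ y k n → y ℤ.+ (1ℤ ℤ.+ k) ℤ.* n ≡ (y ℤ.+ k ℤ.* n) ℤ.+ n
    eq = solve-∀
    eq′ : ∀ j t n → (j ℤ.+ t ℤ.* n) ℤ.+ n ≡ j ℤ.+ (1ℤ ℤ.+ t) ℤ.* n
    eq′ = solve-∀
    ey′ : y ℤ.+ ℤ.suc k ℤ.* + n ≡ + j ℤ.+ ℤ.suc t ℤ.* + n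
    ey′ = trans (eq y k (+ n)) (trans (cong (ℤ._+ + n) ey) (eq′ (+ j) t (+ n)))

  glue-face : ∀ p → Face (glue p) (glue (p +e₁)) (glue (p +e₂)) (glue (p +e₁ +e₂))
  glue-face p@(x , y) =
    face-≡ (sym (glue-block x y i j k t (ℕ.<⇒≤ i<n) (ℕ.<⇒≤ j<n) ex ey))
           (sym (glue-block (ℤ.suc x) y (suc i) j k t i<n (ℕ.<⇒≤ j<n) ex⁺ ey))
           (sym (glue-block x (ℤ.suc y) i (suc j) k t (ℕ.<⇒≤ i<n) j<n ex ey⁺))
           (sym (glue-block (ℤ.suc x) (ℤ.suc y) (suc i) (suc j) k t i<n j<n ex⁺ ey⁺))
           (faces X t i j i<n j<n)
    where
    open Position (locate n p) renaming (x≡ to ex; y≡ to ey)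
    eq : ∀ y k → (1ℤ ℤ.+ y) ℤ.+ k ≡ 1ℤ ℤ.+ (y ℤ.+ k)
    eq = solve-∀
    ex⁺ : ℤ.suc x ≡ + suc i ℤ.+ k ℤ.* + n
    ex⁺ = trans (cong ℤ.suc ex) (sym (ℤ.+-assoc 1ℤ (+ i) (k ℤ.* + n)))
    ey⁺ : ℤ.suc y ℤ.+ k ℤ.* + n ≡ + suc j ℤ.+ t ℤ.* + n
    ey⁺ = trans (eq y (k ℤ.* + n)) (trans (cong ℤ.suc ey) (sym (ℤ.+-assoc 1ℤ (+ j) (t ℤ.* + n))))

  glue-periodic : Periodic n glue
  glue-periodic m p@(x , y) = trans
    (glue-block (x ℤ.+ m ℤ.* + n) (y ℤ.- m ℤ.* + n) i j (k ℤ.+ m) t (ℕ.<⇒≤ i<n) (ℕ.<⇒≤ j<n)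
      (trans (cong (ℤ._+ m ℤ.* + n) ex) (eq (+ i) k m (+ n))) (trans (eq′ y k m (+ n)) ey))
    (sym (glue-block x y i j k t (ℕ.<⇒≤ i<n) (ℕ.<⇒≤ j<n) ex ey))
    where
    open Position (locate n p) renaming (x≡ to ex; y≡ to ey)
    eq : ∀ i k m n → (i ℤ.+ k ℤ.* n) ℤ.+ m ℤ.* n ≡ i ℤ.+ (k ℤ.+ m) ℤ.* n
    eq = solve-∀
    eq′ : ∀ y k m n → (y ℤ.- m ℤ.* n) ℤ.+ (k ℤ.+ m) ℤ.* n ≡ y ℤ.+ k ℤ.* n
    eq′ = solve-∀

field-from : ∀ {n ℓ} (f : Point → Signature ℓ) → Periodic n f →
             (∀ p → Face (f p) (f (p +e₁)) (f (p +e₂)) (f (p +e₁ +e₂))) → FominField n ℓ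
field-from f periodic faces = record
  { field-map  = record { to = f ; cong = λ { {p} (k , refl) → sym (periodic k p) } }
  ; interlace₁ = λ p → face-κ⪯μ (faces p)
  ; interlace₂ = λ p → face-κ⪯lam (faces p)
  ; local-rule = λ p → face⇒IsF̄ (faces p)
  }

field-face : ∀ {n ℓ} (Λ : FominField n ℓ) p →
             Face (at Λ p) (at Λ (p +e₁)) (at Λ (p +e₂)) (at Λ (p +e₁ +e₂))
field-face Λ p = IsF̄⇒face (FominField.interlace₁ Λ p) (FominField.interlace₂ Λ p)
                          (FominField.local-rule Λ p)

field-periodic : ∀ {n ℓ} (Λ : FominField n ℓ) → Periodic n (at Λ)
field-periodic {n} Λ k p = sym (Func.cong (FominField.field-map Λ) {p} {shift n k p} (k , refl))

-- The strip 0 ≤ x ≤ n meets every class of points; its right border is a translate of the left one,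
-- n higher.
field-blocks : ∀ {n ℓ} → FominField n ℓ → Blocks n ℓ
field-blocks {n} Λ = record
  { block = λ t i j → at Λ (+ i , + j ℤ.+ t ℤ.* + n)
  ; top   = λ t i _ → cong (λ y → at Λ (+ i , y))
              (trans (sym (suc-* t (+ n))) (sym (ℤ.+-identityˡ _)))
  ; right = λ t j _ → trans
      (cong (at Λ) (cong₂ _,_ (eq (+ n)) (eq′ (+ j) t (+ n))))
      (field-periodic Λ 1ℤ (0ℤ , + j ℤ.+ ℤ.suc t ℤ.* + n))
  ; faces = λ t i j _ _ → face-≡ refl refl (cong (λ y → at Λ (+ i , y)) (eq″ (+ j) t))
      (cong (λ y → at Λ (+ suc i , y)) (eq″ (+ j) t))
      (field-face Λ (+ i , + j ℤ.+ t ℤ.* + n))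
  }
  where
  eq : ∀ n → n ≡ 0ℤ ℤ.+ 1ℤ ℤ.* n
  eq = solve-∀
  eq′ : ∀ j t n → j ℤ.+ t ℤ.* n ≡ (j ℤ.+ (1ℤ ℤ.+ t) ℤ.* n) ℤ.- 1ℤ ℤ.* n
  eq′ = solve-∀
  eq″ : ∀ j t → 1ℤ ℤ.+ (j ℤ.+ t ℤ.* + n) ≡ (1ℤ ℤ.+ j) ℤ.+ t ℤ.* + n
  eq″ j t = sym (ℤ.+-assoc 1ℤ j _)

field-unique : ∀ {n ℓ} .{{_ : ℕ.NonZero n}} (Λ Λ′ : FominField n ℓ) →
               (∀ i → i ℕ.≤ n → at Λ (+ i , 0ℤ) ≡ at Λ′ (+ i , 0ℤ)) →
               (∀ j → j ℕ.≤ n → at Λ (0ℤ , + j) ≡ at Λ′ (0ℤ , + j)) →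
               ∀ p → at Λ p ≡ at Λ′ p
field-unique {n} Λ Λ′ bot left p with locate n p
... | position k t i j i<n j<n ex ey =
  trans (normalise Λ) (trans (blocks-unique (field-blocks Λ) (field-blocks Λ′) bot left′
    t i j (ℕ.<⇒≤ i<n) (ℕ.<⇒≤ j<n)) (sym (normalise Λ′)))
  where
  left′ : ∀ j → j ℕ.≤ n → at Λ (0ℤ , + j ℤ.+ 0ℤ ℤ.* + n) ≡ at Λ′ (0ℤ , + j ℤ.+ 0ℤ ℤ.* + n)
  left′ j j≤n rewrite ℤ.+-identityʳ (+ j) = left j j≤n
  normalise : ∀ {ℓ} (Λ : FominField n ℓ) → at Λ p ≡ at Λ (+ i , + j ℤ.+ t ℤ.* + n)
  normalise Λ = trans (sym (field-periodic Λ (ℤ.- k) p)) (cong (at Λ) (cong₂ _,_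
    (trans (cong (ℤ._+ ℤ.- k ℤ.* + n) ex) (eq (+ i) k (+ n)))
    (trans (eq′ (proj₂ p) k (+ n)) ey)))
    where
    eq : ∀ i k n → (i ℤ.+ k ℤ.* n) ℤ.+ (ℤ.- k) ℤ.* n ≡ i
    eq = solve-∀
    eq′ : ∀ y k n → y ℤ.- (ℤ.- k) ℤ.* n ≡ y ℤ.+ k ℤ.* n
    eq′ = solve-∀

-- The environment and the limit of a field

length-at : ∀ {n ℓ} → FominField n ℓ → ℤ → Point → ℤ
length-at Λ x p = + conj (at Λ p) x

load-at : ∀ {n ℓ} → FominField n ℓ → ℤ → Point → ℕ
load-at Λ x p = load (at Λ p) (at Λ (p +e₁)) (at Λ (p +e₂)) x

field-column : ∀ {n ℓ} (Λ : FominField n ℓ) x →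
               Column (load-at Λ (ℤ.pred x)) (length-at Λ x) (load-at Λ x)
field-column Λ x p = Face.plaquette (field-face Λ p) x

length-periodic : ∀ {n ℓ} (Λ : FominField n ℓ) x → Periodic n (length-at Λ x)
length-periodic Λ x k p = cong (λ κ → + conj κ x) (field-periodic Λ k p)

past-unique : ∀ {L h k} → Past L h → Past L k → h ≡ k
past-unique pL pL′ with p , e , e′ ← past-point pL pL′ = trans (sym e) e′

future-unique : ∀ {L h k} → Future L h → Future L k → h ≡ k
future-unique fL fL′ with p , e , e′ ← future-point fL fL′ = trans (sym e) e′

module FieldLimit {n ℓ : ℕ} .{{_ : ℕ.NonZero n}} (Λ : FominField n ℓ) where

  private
    L : ℤ → Point → ℤ
    L = length-at Λ

    origin : Point
    origin = 0ℤ , 0ℤ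

    a b : ℤ
    a = proj₁ (conj-full (at Λ origin))
    b = proj₁ (conj-empty (at Λ origin))

    early : ∀ x → b ℤ.≤ x → Past (L x) 0ℤ
    early x b≤x = ℤ.- + n , λ p h → ℤ.≤-antisym
      (subst (L x p ℤ.≤_) (cong +_ (proj₂ (conj-empty (at Λ origin)) x b≤x))
        (column-dominate (field-column Λ x) (length-periodic Λ x) p origin
          (subst (time p ℤ.+ + n ℤ.≤_) (ℤ.+-inverseˡ (+ n)) (ℤ.+-monoˡ-≤ (+ n) h))))
      (ℤ.+≤+ z≤n)

    late : ∀ x → x ℤ.≤ a → Future (L x) (+ ℓ)
    late x x≤a = + n , λ p h → ℤ.≤-antisym (ℤ.+≤+ (conj≤ℓ (at Λ p) x))
      (subst (ℤ._≤ L x p) (cong +_ (proj₂ (conj-full (at Λ origin)) x x≤a))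
        (column-dominate (field-column Λ x) (length-periodic Λ x) origin p
          (subst (ℤ._≤ time p) (sym (ℤ.+-identityˡ (+ n))) h)))

  opaque
    -- For x ≥ `b` column x is empty at the origin, hence by domination at all times ≤ - n. A column
    -- constant in the past admits no early load, so the column to its left emits none and is
    -- constant in the past by `column-past`. `field-future` argues symmetrically from the full
    -- columns on the left.
    field-past : ∀ x → ∃[ h ] Past (L x) h
    field-past = ℤ-descend _ b (λ x h → 0ℤ , early x h) λ x → λ (h , pL) →
      column-past (field-column Λ (ℤ.pred x)) (length-periodic Λ _)
        (proj₁ (column-pastZero (field-column Λ x) pL))

    field-future : ∀ x → ∃[ h ] Future (L x) h
    field-future = ℤ-ascend _ a (λ x h → + ℓ , late x h) λ x → λ (h , fL) →
      column-future (field-column Λ x) (length-periodic Λ _)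
        (proj₂ (column-futureZero (field-column Λ (ℤ.pred x)) fL))

  private
    past-value future-value : ℤ → ℤ
    past-value   x = proj₁ (field-past x)
    future-value x = proj₁ (field-future x)

    height : ∀ x → future-value x ℤ.- past-value x ≡ future-value 0ℤ ℤ.- past-value 0ℤ
    height = ℤ-bidirectional _ refl (λ x e → trans (step x) e) (λ x e → trans (sym (step x)) e)
      where
      step : ∀ x → future-value x ℤ.- past-value x ≡ future-value (ℤ.pred x) ℤ.- past-value (ℤ.pred x)
      step x = height-conserved (field-column Λ (ℤ.pred x)) (field-column Λ x)
        (proj₂ (field-past (ℤ.pred x))) (proj₂ (field-future (ℤ.pred x)))
        (proj₂ (field-past x)) (proj₂ (field-future x))

    f : ℤ → ℕ
    f x = ℤ.∣ past-value x ∣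

    -- Two past values occur in one early signature of the field; antitonicity and `m ≤ ℓ` are
    -- inherited from its conjugate.
    f-attained : ∀ x y → ∃[ p ] f x ≡ conj (at Λ p) x × f y ≡ conj (at Λ p) y
    f-attained x y with p , e , e′ ← past-point (proj₂ (field-past x)) (proj₂ (field-past y)) =
      p , cong ℤ.∣_∣ (sym e) , cong ℤ.∣_∣ (sym e′)

    f-past : ∀ x → Past (L x) (+ f x)
    f-past x = let s , pL = proj₂ (field-past x) in s , λ p h → cong (λ z → + ℤ.∣ z ∣) (pL p h)

    f-antitone : ∀ x → f x ℕ.≤ f (ℤ.pred x)
    f-antitone x with p , e , e′ ← f-attained x (ℤ.pred x) = subst₂ ℕ._≤_ (sym e) (sym e′)
      (conj-antitone (at Λ p) (ℤ.i≤j⇒pred[i]≤j ℤ.≤-refl))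

    m : ℕ
    m = f a

    -- Left of all parts the final length is ℓ, so the initial one is ℓ - height.
    f-full : ∀ x → x ℤ.≤ a → f x ≡ m
    f-full x x≤a = cong ℤ.∣_∣ (ℤ.neg-injective {past-value x} {past-value a} (+-cancelˡ (+ ℓ) _ _
      (subst₂ (λ u v → u ℤ.- past-value x ≡ v ℤ.- past-value a)
        (future-unique (proj₂ (field-future x)) (late x x≤a))
        (future-unique (proj₂ (field-future a)) (late a ℤ.≤-refl))
        (trans (height x) (sym (height a))))))

    f-empty : ∀ x → b ℤ.≤ x → f x ≡ 0
    f-empty x b≤x = cong ℤ.∣_∣ (past-unique (proj₂ (field-past x)) (early x b≤x))

  opaque
    limit-exists : Σ[ ν ∈ Signature m ] ∀ x → Past (L x) (+ conj ν x)
    limit-exists = fromConj f f-antitone a b f-full f-empty , λ x →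
      subst (Past (L x)) (cong +_ (sym (conj-fromConj f f-antitone a b f-full f-empty x))) (f-past x)

  limit-signature : 𝕊
  limit-signature = m , proj₁ limit-exists

  limit-past : ∀ x → Past (L x) (+ conj (proj₂ limit-signature) x)
  limit-past = proj₂ limit-exists

  private
    ν : Signature m
    ν = proj₂ limit-signature

  -- Each column freezes at a time of its own. A row i below `m` is pinned by the columns νᵢ and νᵢ
  -- + 1. A row i ≥ `m` with limit z would give column z a frozen length above i, whereas ν has only
  -- `m` rows.
  limit-isLimit : IsLimit Λ limit-signature
  limit-isLimit = record { m≤ℓ = m≤ℓ ; limits = limits ; maximal = maximal }
    where
    m≤ℓ : m ℕ.≤ ℓ
    m≤ℓ with p , e , _ ← f-attained a a = subst (ℕ._≤ ℓ) (sym e) (conj≤ℓ (at Λ p) a)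
    frozen : ∀ x → ∃[ T ] ∀ t → t ℤ.≤ T → conj (at Λ (t , 0ℤ)) x ≡ conj ν x
    frozen x = let s , pL = limit-past x in s , λ t h →
      ℤ.+-injective (pL (t , 0ℤ) (subst (ℤ._≤ s) (sym (ℤ.+-identityʳ t)) h))
    limits : ∀ i → row Λ (inject≤ i m≤ℓ) ⟶ part ν i
    limits i with s , F ← frozen (part ν i) | s′ , F′ ← frozen (ℤ.suc (part ν i)) =
      s ℤ.⊓ s′ , λ t h → ℤ.≤-antisym
        (upper t (F′ t (ℤ.≤-trans h (ℤ.i⊓j≤j s s′))))
        (<conj⇒≤part (at Λ (t , 0ℤ)) i′ (subst₂ ℕ._<_ (sym i≡)
          (sym (F t (ℤ.≤-trans h (ℤ.i⊓j≤i s s′)))) (≤part⇒<conj ν i ℤ.≤-refl)))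
      where
      i′ : Fin ℓ
      i′ = inject≤ i m≤ℓ
      i≡ : toℕ i′ ≡ toℕ i
      i≡ = Fin.toℕ-inject≤ i m≤ℓ
      upper : ∀ t → conj (at Λ (t , 0ℤ)) (ℤ.suc (part ν i)) ≡ conj ν (ℤ.suc (part ν i)) →
              row Λ i′ t ℤ.≤ part ν i
      upper t e with row Λ i′ t ℤ.≤? part ν i
      ... | yes h = h
      ... | no  h = contradiction (<conj⇒≤part ν i (subst₂ ℕ._<_ i≡ e
                      (≤part⇒<conj (at Λ (t , 0ℤ)) i′ (≰⇒suc≤ h)))) suc≰
    maximal : ∀ i → m ℕ.≤ toℕ i → ¬ (∃[ z ] row Λ i ⟶ z)
    maximal i m≤i (z , T , F) with s , G ← frozen z =
      ℕ.<⇒≱ (ℕ.<-≤-trans (subst (toℕ i ℕ.<_) (G t (ℤ.i⊓j≤j T s))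
        (≤part⇒<conj (at Λ (t , 0ℤ)) i (ℤ.≤-reflexive (sym (F t (ℤ.i⊓j≤i T s))))))
        (conj≤ℓ ν z)) m≤i
      where
      t : ℤ
      t = T ℤ.⊓ s

  environment-finite : FinitelySupported {n} (environment Λ)
  environment-finite
    with _ , (s , Zs) ← column-pastZero (field-column Λ 0ℤ) (proj₂ (field-past 0ℤ))
       | _ , (e , Ze) ← column-futureZero (field-column Λ 0ℤ) (proj₂ (field-future 0ℤ)) =
    List.map cell (cartesianProduct (upTo n) (upTo ℤ.∣ e ℤ.- s ∣)) , λ p nz →
      supported p (ℤ.<⇒≤ (ℤ.≰⇒> (λ h → nz (Zs p h)))) (ℤ.≰⇒> (λ h → nz (Ze p h)))
    where
    -- The representative with abscissa i in [0 , n) and time s + d; the support lies strictly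
    -- between the times s and e.
    cell : ℕ × ℕ → Point
    cell (i , d) = + i , (s ℤ.+ + d) ℤ.- + i
    supported : ∀ p → s ℤ.≤ time p → time p ℤ.< e →
                Any.Any (p ≈[ n ]_) (List.map cell (cartesianProduct (upTo n) (upTo ℤ.∣ e ℤ.- s ∣)))
    supported p@(x , y) s≤ <e = Any.map (λ { refl → ℤ.- k , cong₂ _,_
        (trans (eq₁ (+ i) k (+ n)) (cong (λ z → z ℤ.+ ℤ.- k ℤ.* + n) (sym x≡)))
        (trans (cong (ℤ._- + i) s+d≡) (trans (cong (λ z → (z ℤ.+ y) ℤ.- + i) x≡) (eq₂ (+ i) k (+ n) y))) })
      (∈-map⁺ cell (∈-cartesianProduct⁺ (∈-upTo⁺ i<n) (∈-upTo⁺ d<)))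
      where
      open Position (locate n p) using (k; i; i<n; x≡)
      d : ℕ
      d = ℤ.∣ time p ℤ.- s ∣
      +d≡ : + d ≡ time p ℤ.- s
      +d≡ = ℤ.0≤i⇒+∣i∣≡i (ℤ.i≤j⇒0≤j-i s≤)
      d< : d ℕ.< ℤ.∣ e ℤ.- s ∣
      d< = ℤ.drop‿+<+ (subst₂ ℤ._<_ (sym +d≡)
             (sym (ℤ.0≤i⇒+∣i∣≡i (ℤ.i≤j⇒0≤j-i (ℤ.≤-trans s≤ (ℤ.<⇒≤ <e)))))
             (ℤ.+-monoˡ-< (ℤ.- s) <e))
      eq₀ : ∀ s t → s ℤ.+ (t ℤ.- s) ≡ t
      eq₀ = solve-∀
      s+d≡ : s ℤ.+ + d ≡ time p
      s+d≡ = trans (cong (λ z → s ℤ.+ z) +d≡) (eq₀ s (time p))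
      eq₁ : ∀ i k n → i ≡ (i ℤ.+ k ℤ.* n) ℤ.+ (ℤ.- k) ℤ.* n
      eq₁ = solve-∀
      eq₂ : ∀ i k n y → ((i ℤ.+ k ℤ.* n) ℤ.+ y) ℤ.- i ≡ y ℤ.- (ℤ.- k) ℤ.* n
      eq₂ = solve-∀

open FieldLimit using (field-past; field-future; limit-signature; limit-past; limit-isLimit;
                              environment-finite)

-- The load and the initial length of a column determine the column and the
-- load in the next one, in both directions.
field-determined : ∀ {n ℓ ℓ′} .{{_ : ℕ.NonZero n}} (Λ : FominField n ℓ) (Λ′ : FominField n ℓ′) →
  (∀ p → environment Λ ⟨$⟩ p ≡ environment Λ′ ⟨$⟩ p) →
  limit-signature Λ ≡ limit-signature Λ′ →
  ∀ p → _≡_ {A = 𝕊} (ℓ , at Λ p) (ℓ′ , at Λ′ p)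
field-determined Λ Λ′ env lim p = conj-injective-𝕊 λ x →
  ℤ.+-injective (proj₁ (forward x (loads (ℤ.pred x))) p)
  where
  past′ : ∀ x → Past (length-at Λ′ x) (+ conj (proj₂ (limit-signature Λ)) x)
  past′ x = subst (λ ν → Past (length-at Λ′ x) (+ conj (proj₂ ν) x)) (sym lim) (limit-past Λ′ x)
  forward : ∀ x → (∀ p → load-at Λ (ℤ.pred x) p ≡ load-at Λ′ (ℤ.pred x) p) →
            (∀ p → length-at Λ x p ≡ length-at Λ′ x p) × (∀ p → load-at Λ x p ≡ load-at Λ′ x p)
  forward x same = column-det (field-column Λ x) (field-column Λ′ x) same (limit-past Λ x) (past′ x)
  loads : ∀ x p → load-at Λ x p ≡ load-at Λ′ x p
  loads = ℤ-bidirectional _ env (λ x same → proj₂ (forward x same))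
    (λ x same → proj₂ (column-det-back (field-column Λ x) (field-column Λ′ x) same
      (limit-past Λ x) (past′ x) (proj₂ (field-future Λ x)) (proj₂ (field-future Λ′ x))))

limit-signature-unique : ∀ {n ℓ} .{{_ : ℕ.NonZero n}} (Λ : FominField n ℓ) (ν : 𝕊) →
  (∀ x → Past (length-at Λ x) (+ conj (proj₂ ν) x)) → limit-signature Λ ≡ ν
limit-signature-unique Λ ν past = conj-injective-𝕊 λ x →
  ℤ.+-injective (past-unique (limit-past Λ x) (past x))

-- Finitely supported pulses passing through columns

record Pulse (n : ℕ) : Set where
  field
    pulse    : Point → ℕ
    periodic : Periodic n pulse
    start    : ℤ
    before   : ∀ p → time p ℤ.≤ start → pulse p ≡ 0
    stop     : ℤ
    after    : ∀ p → stop ℤ.≤ time p → pulse p ≡ 0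

open Pulse

-- Lengths are normalised to the past value 0; the conjugate of the limit is added only in
-- `PulseField`.
record Passage {n} (c c′ : Pulse n) : Set where
  field
    len      : Point → ℤ
    column   : Column (pulse c) len (pulse c′)
    periodic : Periodic n len
    past     : Past len 0ℤ
    height   : ℤ
    future   : Future len height

  quiet : ∀ p → time p ℤ.≤ start c → len p ≡ 0ℤ
  quiet p h = proj₁ (column-quiet column past (start c) (before c)) p (≤-suc (≤-suc h))

  0≤len : ∀ p → 0ℤ ℤ.≤ len p
  0≤len = past-induction _ (proj₁ past) (λ p h → ℤ.≤-reflexive (sym (proj₂ past p h)))
    (λ q h _ _ → ℤ.≤-trans h (ℤ.≤-trans (plaq-l≤l₁ (column q)) (plaq-l₁≤l₁₂ (column q))))

open Passage

-- The last length of a plaquette as a total function, so that `D` can be defined before its values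
-- are known to interlace.
next-length : (c l l₁ l₂ : ℕ) → ℕ
next-length zero    l l₁ l₂ = l₁ ℕ.⊔ l₂
next-length (suc c) l l₁ l₂ = suc l

plaq-next-length : ∀ {c l l₁ l₂ v c′} → Plaq c (+ l) (+ l₁) (+ l₂) (+ v) c′ →
                   v ≡ next-length c l l₁ l₂
plaq-next-length (idle  {+ l})         = sym (ℕ.⊔-idem l)
plaq-next-length (drop  {_} {+ l})     = refl
plaq-next-length (pass₁ {zero} {+ l})  = sym (ℕ.m≥n⇒m⊔n≡m (ℕ.n≤1+n l))
plaq-next-length (pass₁ {suc _} {+ l}) = refl
plaq-next-length (pass₂ {zero} {+ l})  = sym (ℕ.m≤n⇒m⊔n≡n (ℕ.n≤1+n l))
plaq-next-length (pass₂ {suc _} {+ l}) = refl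
plaq-next-length (take  {zero} {+ l})  = cong suc (sym (ℕ.⊔-idem l))
plaq-next-length (take  {suc _} {+ l}) = refl

module Transmission {n : ℕ} .{{_ : ℕ.NonZero n}} (C : Pulse n) where

  private
    c : Point → ℕ
    c = pulse C

    s : ℤ
    s = start C

    -- Recursion on the time elapsed since `s`. A value depends on the two preceding times, so
    -- elapsed times 0 and 1 are both base cases.
    D-at : ℕ → Point → ℕ
    D-at zero          p       = 0
    D-at (suc zero)    p       = 0
    D-at (suc (suc k)) (x , y) = next-length (c (ℤ.pred x , ℤ.pred y))
      (D-at k (ℤ.pred x , ℤ.pred y)) (D-at (suc k) (x , ℤ.pred y)) (D-at (suc k) (ℤ.pred x , y))

    D : Point → ℕ
    D p = D-at (positivePart (time p ℤ.- s)) p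

    D-early : ∀ p → time p ℤ.≤ ℤ.suc s → D p ≡ 0
    D-early p h = go (time p ℤ.- s) (subst (time p ℤ.- s ℤ.≤_) (eq s) (ℤ.+-monoˡ-≤ (ℤ.- s) h))
      where
      eq : ∀ s → (1ℤ ℤ.+ s) ℤ.- s ≡ 1ℤ
      eq = solve-∀
      go : ∀ z → z ℤ.≤ 1ℤ → D-at (positivePart z) p ≡ 0
      go (+ zero)        _                  = refl
      go (+ suc zero)    _                  = refl
      go (+ suc (suc k)) (ℤ.+≤+ (s≤s ()))
      go -[1+ k ]        _                  = refl

    D≡ : ∀ j p → time p ≡ s ℤ.+ + j → D p ≡ D-at j p
    D≡ j p e = cong (λ z → D-at (positivePart z) p) (trans (cong (ℤ._- s) e) (eq s (+ j)))
      where
      eq : ∀ s j → (s ℤ.+ j) ℤ.- s ≡ j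
      eq = solve-∀

    D-step : ∀ q → D (q +e₁ +e₂) ≡ next-length (c q) (D q) (D (q +e₁)) (D (q +e₂))
    D-step q@(x , y) with s ℤ.≤? time q
    ... | no s≰ = trans (D-early (q +e₁ +e₂) t₁₂)
          (sym (next≡0 (before C q (ℤ.<⇒≤ (ℤ.≰⇒> s≰)))
                 (D-early q (ℤ.≤-trans (time-≤-+e₁+e₂ q) t₁₂))
                 (D-early (q +e₁) (ℤ.≤-trans (time-≤-+e₂ (q +e₁)) t₁₂))
                 (D-early (q +e₂) (ℤ.≤-trans (time-≤-+e₁ (q +e₂)) t₁₂))))
      where
      t₁₂ : time (q +e₁ +e₂) ℤ.≤ ℤ.suc s
      t₁₂ = subst (ℤ._≤ ℤ.suc s) (sym (time-+e₁+e₂ q)) (ℤ.suc-mono (≰⇒suc≤ s≰))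
      next≡0 : ∀ {k l l₁ l₂} → k ≡ 0 → l ≡ 0 → l₁ ≡ 0 → l₂ ≡ 0 → next-length k l l₁ l₂ ≡ 0
      next≡0 refl refl refl refl = refl
    ... | yes s≤ = trans (D≡ (suc (suc j)) (q +e₁ +e₂) (trans (time-+e₁+e₂ q) (e₁₂)))
          (next-≡ (cong c q≡) (trans (cong (D-at j) q≡) (sym (D≡ j q e)))
            (trans (cong (λ z → D-at (suc j) (ℤ.suc x , z)) (ℤ.pred-suc y))
                   (sym (D≡ (suc j) (q +e₁) (trans (time-+e₁ q) e₁))))
            (trans (cong (λ z → D-at (suc j) (z , ℤ.suc y)) (ℤ.pred-suc x))
                   (sym (D≡ (suc j) (q +e₂) (trans (time-+e₂ q) e₁)))))
      where
      j : ℕ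
      j = ℤ.∣ time q ℤ.- s ∣
      eq : ∀ s t → t ≡ s ℤ.+ (t ℤ.- s)
      eq = solve-∀
      eq⁺ : ∀ s t → 1ℤ ℤ.+ (s ℤ.+ t) ≡ s ℤ.+ (1ℤ ℤ.+ t)
      eq⁺ = solve-∀
      e : time q ≡ s ℤ.+ + j
      e = trans (eq s (time q)) (cong (λ z → s ℤ.+ z) (sym (ℤ.0≤i⇒+∣i∣≡i (ℤ.i≤j⇒0≤j-i s≤))))
      e₁ : ℤ.suc (time q) ≡ s ℤ.+ + suc j
      e₁ = trans (cong ℤ.suc e) (eq⁺ s (+ j))
      e₁₂ : ℤ.suc (ℤ.suc (time q)) ≡ s ℤ.+ + suc (suc j)
      e₁₂ = trans (cong ℤ.suc e₁) (eq⁺ s (+ suc j))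
      q≡ : (ℤ.pred (ℤ.suc x) , ℤ.pred (ℤ.suc y)) ≡ q
      q≡ = cong₂ _,_ (ℤ.pred-suc x) (ℤ.pred-suc y)
      next-≡ : ∀ {k k′ l l′ l₁ l₁′ l₂ l₂′} → k ≡ k′ → l ≡ l′ → l₁ ≡ l₁′ → l₂ ≡ l₂′ →
               next-length k l l₁ l₂ ≡ next-length k′ l′ l₁′ l₂′
      next-≡ refl refl refl refl = refl

    -- `plaq-exists` needs steps of 0 or 1 from q to q + e₁ and to q + e₂. These are edges entering
    -- later corners, so the induction hypothesis is attached to the end of an edge.
    Incoming : Point → Set
    Incoming p = ∀ r → p ≡ r +e₁ ⊎ p ≡ r +e₂ → D r ℕ.≤ D p × D p ℕ.≤ suc (D r)

    new : ∀ q → Incoming (q +e₁) → Incoming (q +e₂) →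
          ∃[ c′ ] Plaq (c q) (+ D q) (+ D (q +e₁)) (+ D (q +e₂)) (+ D (q +e₁ +e₂)) c′
    new q i₁ i₂ =
      let l≤₁ , ≤l₁ = i₁ q (inj₁ refl)
          l≤₂ , ≤l₂ = i₂ q (inj₂ refl)
          v , c′ , P = plaq-exists (c q) l≤₁ ≤l₁ l≤₂ ≤l₂
      in c′ , plaq-≡ refl refl refl refl
                (cong +_ (trans (plaq-next-length P) (sym (D-step q)))) refl P

    incoming : ∀ p → Incoming p
    incoming = past-induction Incoming (ℤ.suc s) base step
      where
      base : ∀ p → time p ℤ.≤ ℤ.suc s → Incoming p
      base p t r edge = subst₂ (λ u v → u ℕ.≤ v × v ℕ.≤ suc u)
          (sym (D-early r (ℤ.≤-trans (r≤p edge) t))) (sym (D-early p t)) (z≤n , z≤n)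
        where
        r≤p : p ≡ r +e₁ ⊎ p ≡ r +e₂ → time r ℤ.≤ time p
        r≤p (inj₁ refl) = time-≤-+e₁ r
        r≤p (inj₂ refl) = time-≤-+e₂ r
      step : ∀ q → Incoming q → Incoming (q +e₁) → Incoming (q +e₂) → Incoming (q +e₁ +e₂)
      step q@(x , y) _ i₁ i₂ r edge with c′ , P ← new q i₁ i₂ = go r edge
        where
        ok : ∀ u → + D q ℤ.≤ + D u → + D u ℤ.≤ + D (q +e₁ +e₂) →
             D u ℕ.≤ D (q +e₁ +e₂) × D (q +e₁ +e₂) ℕ.≤ suc (D u)
        ok u h h′ = ℤ.drop‿+≤+ h′ ,
          ℤ.drop‿+≤+ (ℤ.≤-trans (plaq-l₁₂≤suc-l P) (ℤ.suc-mono h))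
        go : ∀ r → q +e₁ +e₂ ≡ r +e₁ ⊎ q +e₁ +e₂ ≡ r +e₂ →
             D r ℕ.≤ D (q +e₁ +e₂) × D (q +e₁ +e₂) ℕ.≤ suc (D r)
        go (rx , ry) (inj₁ e) with refl ← suc-injective {x} {rx} (cong proj₁ e) | refl ← cong proj₂ e =
          ok (q +e₂) (plaq-l≤l₂ P) (plaq-l₂≤l₁₂ P)
        go (rx , ry) (inj₂ e) with refl ← cong proj₁ e | refl ← suc-injective {y} {ry} (cong proj₂ e) =
          ok (q +e₁) (plaq-l≤l₁ P) (plaq-l₁≤l₁₂ P)

    c′ : Point → ℕ
    c′ q = proj₁ (new q (incoming (q +e₁)) (incoming (q +e₂)))

    L : Point → ℤ
    L p = + D p

    col : Column c L c′
    col q = proj₂ (new q (incoming (q +e₁)) (incoming (q +e₂)))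

    L-past : Past L 0ℤ
    L-past = ℤ.suc s , λ p h → cong +_ (D-early p h)

    time-shift : ∀ k p → time (shift n k p) ≡ time p
    time-shift k (x , y) = eq x y (k ℤ.* + n)
      where
      eq : ∀ x y z → (x ℤ.+ z) ℤ.+ (y ℤ.- z) ≡ x ℤ.+ y
      eq = solve-∀

    col-shift : ∀ k → Column (c ∘ shift n k) (L ∘ shift n k) (c′ ∘ shift n k)
    col-shift k p@(x , y) =
      plaq-≡ refl refl (cong (λ z → L (z , y ℤ.- k ℤ.* + n)) ex) (cong (λ z → L (x ℤ.+ k ℤ.* + n , z)) ey)
             (cong L (cong₂ _,_ ex ey)) refl (col (shift n k p))
      where
      ex : ℤ.suc (x ℤ.+ k ℤ.* + n) ≡ ℤ.suc x ℤ.+ k ℤ.* + n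
      ex = sym (ℤ.+-assoc 1ℤ x (k ℤ.* + n))
      ey : ℤ.suc (y ℤ.- k ℤ.* + n) ≡ ℤ.suc y ℤ.- k ℤ.* + n
      ey = sym (ℤ.+-assoc 1ℤ y (ℤ.- (k ℤ.* + n)))

    -- The translated column has the same entering pulse and the same past, so `column-det`
    -- identifies the two.
    shifted : ∀ k → (∀ p → L (shift n k p) ≡ L p) × (∀ p → c′ (shift n k p) ≡ c′ p)
    shifted k = column-det (col-shift k) col (Pulse.periodic C k)
      (ℤ.suc s , λ p h → proj₂ L-past (shift n k p) (subst (ℤ._≤ ℤ.suc s) (sym (time-shift k p)) h))
      L-past

    L-future : ∃[ h ] Future L h
    L-future = column-future col (λ k → proj₁ (shifted k)) (stop C , after C)

  opaque
    transmitted : Pulse n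
    transmitted = record
      { pulse    = c′
      ; periodic = λ k → proj₂ (shifted k)
      -- The same start for every pulse of the sequence gives `drift` a base case uniform in the
      -- column.
      ; start    = s
      ; before   = proj₂ (column-quiet col L-past s (before C))
      ; stop     = proj₁ (proj₂ (column-futureZero col (proj₂ L-future)))
      ; after    = proj₂ (proj₂ (column-futureZero col (proj₂ L-future)))
      }

    start-transmitted : start transmitted ≡ s
    start-transmitted = refl

    passage : Passage C transmitted
    passage = record
      { len      = L
      ; column   = col
      ; periodic = λ k → proj₁ (shifted k)
      ; past     = L-past
      ; height   = proj₁ L-future
      ; future   = proj₂ L-future
      }

open Transmission using (transmitted; start-transmitted; passage)

opaque
  reflect-pulse : ∀ {n} → Pulse n → Pulse n
  reflect-pulse {n} C = record
    { pulse    = pulse C ∘ opposite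
    ; periodic = λ { k (x , y) → trans
        (cong (pulse C) (cong₂ _,_ (eq x k (+ n)) (eq′ y k (+ n))))
        (Pulse.periodic C (ℤ.- k) (opposite (x , y))) }
    ; start    = proj₁ reflected-before
    ; before   = proj₂ reflected-before
    ; stop     = proj₁ reflected-after
    ; after    = proj₂ reflected-after
    }
    where
    reflected-before : PastZero (pulse C ∘ opposite)
    reflected-before = pastZero-opposite {pulse C} (stop C , after C)
    reflected-after : FutureZero (pulse C ∘ opposite)
    reflected-after = futureZero-opposite {pulse C} (start C , before C)
    eq : ∀ x k n → ℤ.- (1ℤ ℤ.+ (x ℤ.+ k ℤ.* n)) ≡ ℤ.- (1ℤ ℤ.+ x) ℤ.+ (ℤ.- k) ℤ.* n
    eq = solve-∀
    eq′ : ∀ y k n → ℤ.- (1ℤ ℤ.+ (y ℤ.- k ℤ.* n)) ≡ ℤ.- (1ℤ ℤ.+ y) ℤ.- (ℤ.- k) ℤ.* n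
    eq′ = solve-∀

  pulse-reflect-pulse : ∀ {n} (C : Pulse n) p → pulse (reflect-pulse C) p ≡ pulse C (opposite p)
  pulse-reflect-pulse C p = refl

  -- The reflected lengths start from - `height T`; adding `height T` restores the past value 0 and
  -- leaves the height unchanged.
  reflect-passage : ∀ {n} {C C′ : Pulse n} → Passage C C′ →
                    Passage (reflect-pulse C′) (reflect-pulse C)
  reflect-passage {n} {C} {C′} T = record
    { len      = λ p → reflect (len T) p ℤ.+ height T
    ; column   = column-shift (height T) (column-reflect {pulse C} {len T} {pulse C′} (column T))
    ; periodic = λ k p → cong (ℤ._+ height T) (periodic-reflect (Passage.periodic T) k p)
    ; past     = let s , pL = past-reflect {len T} (future T)
                 in s , λ p h → trans (cong (ℤ._+ height T) (pL p h)) (ℤ.+-inverseˡ (height T))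
    ; height   = height T
    ; future   = let s , fL = future-reflect {len T} (past T)
                 in s , λ p h → trans (cong (ℤ._+ height T) (fL p h)) (ℤ.+-identityˡ (height T))
    }

  len-reflect-passage : ∀ {n} {C C′ : Pulse n} (T : Passage C C′) p →
                        len (reflect-passage T) p ≡ reflect (len T) p ℤ.+ height (reflect-passage T)
  len-reflect-passage T p = refl

passage-resp : ∀ {n} {C C′ C″ : Pulse n} → (∀ p → pulse C′ p ≡ pulse C″ p) →
               Passage C C′ → Passage C C″
passage-resp e T = record
  { len      = len T
  ; column   = λ p → plaq-≡ refl refl refl refl refl (e p) (column T p)
  ; periodic = Passage.periodic T
  ; past     = past T
  ; height   = height T
  ; future   = future T
  }

module PulseSequence {n : ℕ} .{{_ : ℕ.NonZero n}} (C : Pulse n) where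

  pulses : ℕ → Pulse n
  pulses zero    = C
  pulses (suc k) = transmitted (pulses k)

  private
    L : ℕ → Point → ℤ
    L k = len (passage (pulses k))

    start-pulses : ∀ k → start (pulses k) ≡ start C
    start-pulses zero    = refl
    start-pulses (suc k) = trans (start-transmitted (pulses k)) (start-pulses k)

  -- Once the columns are empty around a face, each column removes one unit of
  -- load from the pulse there.
  drift : ∀ p → ∃[ K ] ∀ k → K ℕ.≤ k → L k p ≡ 0ℤ
  drift = past-induction _ (start C)
    (λ p h → 0 , λ k _ → quiet (passage (pulses k)) p (subst (time p ℤ.≤_) (sym (start-pulses k)) h))
    step
    where
    step : ∀ q → _ → _ → _ → ∃[ K ] ∀ k → K ℕ.≤ k → L k (q +e₁ +e₂) ≡ 0ℤ
    step q (K , Z) (K₁ , Z₁) (K₂ , Z₂) = M ℕ.+ pulse (pulses M) q , λ k h →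
      let M≤k = ℕ.≤-trans (ℕ.m≤m+n M _) h
      in trans (proj₂ (flat k M≤k) (dies k h)) (Z k (ℕ.≤-trans K≤M M≤k))
      where
      M : ℕ
      M = K ℕ.⊔ (K₁ ℕ.⊔ K₂)
      K≤M : K ℕ.≤ M
      K≤M = ℕ.m≤m⊔n K _
      K₁≤M : K₁ ℕ.≤ M
      K₁≤M = ℕ.≤-trans (ℕ.m≤m⊔n K₁ K₂) (ℕ.m≤n⊔m K _)
      K₂≤M : K₂ ℕ.≤ M
      K₂≤M = ℕ.≤-trans (ℕ.m≤n⊔m K₁ K₂) (ℕ.m≤n⊔m K _)
      flat : ∀ k → M ℕ.≤ k → pulse (pulses (suc k)) q ≡ pulse (pulses k) q ∸ 1 ×
                             (pulse (pulses k) q ≡ 0 → L k (q +e₁ +e₂) ≡ L k q)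
      flat k h = plaq-flat (column (passage (pulses k)) q)
        (trans (Z₁ k (ℕ.≤-trans K₁≤M h)) (sym (Z k (ℕ.≤-trans K≤M h))))
        (trans (Z₂ k (ℕ.≤-trans K₂≤M h)) (sym (Z k (ℕ.≤-trans K≤M h))))
      decay : ∀ j → pulse (pulses (j ℕ.+ M)) q ≡ pulse (pulses M) q ∸ j
      decay zero    = refl
      decay (suc j) = trans (proj₁ (flat (j ℕ.+ M) (ℕ.m≤n+m M j)))
        (trans (cong (_∸ 1) (decay j))
        (trans (ℕ.∸-+-assoc (pulse (pulses M) q) j 1)
               (cong (pulse (pulses M) q ∸_) (ℕ.+-comm j 1))))
      dies : ∀ k → M ℕ.+ pulse (pulses M) q ℕ.≤ k → pulse (pulses k) q ≡ 0
      dies k h = trans (cong (λ i → pulse (pulses i) q) (sym (ℕ.m∸n+n≡m (ℕ.≤-trans (ℕ.m≤m+n M _) h))))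
        (trans (decay (k ∸ M)) (ℕ.m≤n⇒m∸n≡0
          (ℕ.m+n≤o⇒m≤o∸n (pulse (pulses M) q) (subst (ℕ._≤ k) (ℕ.+-comm M _) h))))

open PulseSequence using (pulses; drift)

module TwoSided {n : ℕ} .{{_ : ℕ.NonZero n}} (C : Pulse n) where

  private
    back : ℕ → Pulse n
    back = pulses (reflect-pulse C)

  -- To the left of `C` the reflected pulse is sent forward through columns and the results are
  -- reflected back.
  pulse-in : ℤ → Pulse n
  pulse-in (+ k)    = pulses C k
  pulse-in -[1+ k ] = reflect-pulse (back (suc k))

  passage-in : ∀ x → Passage (pulse-in (ℤ.pred x)) (pulse-in x)
  -- The two halves meet here: reflecting `C` twice gives back its values only pointwise, hence
  -- `passage-resp`.
  passage-in (+ zero)  = passage-resp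
    (λ p → trans (pulse-reflect-pulse (reflect-pulse C) p)
           (trans (pulse-reflect-pulse C (opposite p)) (cong (pulse C) (opposite-involutive p))))
    (reflect-passage (passage (reflect-pulse C)))
  passage-in (+ suc k) = passage (pulses C k)
  passage-in -[1+ k ]  = reflect-passage (passage (back (suc k)))

  L : ℤ → Point → ℤ
  L x = len (passage-in x)

  height-in : ∀ x → height (passage-in x) ≡ height (passage-in 0ℤ)
  height-in = ℤ-bidirectional _ refl (λ x e → trans (step x) e) (λ x e → trans (sym (step x)) e)
    where
    step : ∀ x → height (passage-in x) ≡ height (passage-in (ℤ.pred x))
    step x = +-cancelʳ 0ℤ _ _ (height-conserved (column (passage-in (ℤ.pred x))) (column (passage-in x))
      (past (passage-in (ℤ.pred x))) (future (passage-in (ℤ.pred x)))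
      (past (passage-in x)) (future (passage-in x)))

  L-antitone : ∀ x p → L x p ℤ.≤ L (ℤ.pred x) p
  L-antitone x = column-compare-past (column (passage-in (ℤ.pred x))) (column (passage-in x))
    (past (passage-in (ℤ.pred x))) (past (passage-in x)) ℤ.≤-refl

  L-empty : ∀ p → ∃[ b ] ∀ x → b ℤ.≤ x → L x p ≡ 0ℤ
  L-empty p with K , Z ← drift C p = + suc K , λ { (+ suc k) (ℤ.+≤+ (s≤s h)) → Z k h }

  -- By `drift` the reflected columns are eventually 0 at `neg p`. Undoing the reflection turns 0
  -- into the height, which is the same for all columns.
  L-full : ∀ p → ∃[ a ] ∀ x → x ℤ.≤ a → L x p ≡ height (passage-in 0ℤ)
  L-full p with K , Z ← drift (reflect-pulse C) (neg p) = -[1+ K ] , λ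
    { -[1+ k ] (ℤ.-≤- h) → trans (len-reflect-passage (passage (back (suc k))) p)
        (trans (cong₂ (λ u v → ℤ.- u ℤ.+ v) (Z (suc k) (ℕ.m≤n⇒m≤1+n h)) (height-in -[1+ k ]))
               (ℤ.+-identityˡ _)) }

-- The field with given environment and limit

module PulseField {n : ℕ} .{{_ : ℕ.NonZero n}} (C : Pulse n) (mν : 𝕊) where

  open TwoSided C

  private
    ν : Signature (proj₁ mν)
    ν = proj₂ mν

    +∣L∣ : ∀ x p → + ℤ.∣ L x p ∣ ≡ L x p
    +∣L∣ x p = ℤ.0≤i⇒+∣i∣≡i (0≤len (passage-in x) p)

  -- The common value of all conjugates far to the left, where `L` equals the height and every row
  -- of ν is present.
  size : ℕ
  size = ℤ.∣ height (passage-in 0ℤ) ∣ ℕ.+ proj₁ mν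

  private
    f : Point → ℤ → ℕ
    f p x = ℤ.∣ L x p ∣ ℕ.+ conj ν x

    f-antitone : ∀ p x → f p x ≤ f p (ℤ.pred x)
    f-antitone p x = ℕ.+-mono-≤
      (ℤ.drop‿+≤+ (subst₂ ℤ._≤_ (sym (+∣L∣ x p)) (sym (+∣L∣ (ℤ.pred x) p)) (L-antitone x p)))
      (conj-antitone ν (ℤ.i≤j⇒pred[i]≤j ℤ.≤-refl))

    f-full : ∀ p → ∃[ a ] ∀ x → x ℤ.≤ a → f p x ≡ size
    f-full p =
      let a , L≡ = L-full p
          b , ν≡ = conj-full ν
      in a ℤ.⊓ b , λ x h → cong₂ (λ u v → ℤ.∣ u ∣ ℕ.+ v)
           (L≡ x (ℤ.≤-trans h (ℤ.i⊓j≤i a b))) (ν≡ x (ℤ.≤-trans h (ℤ.i⊓j≤j a b)))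

    f-empty : ∀ p → ∃[ b ] ∀ x → b ℤ.≤ x → f p x ≡ 0
    f-empty p =
      let a , L≡ = L-empty p
          b , ν≡ = conj-empty ν
      in a ℤ.⊔ b , λ x h → cong₂ (λ u v → ℤ.∣ u ∣ ℕ.+ v)
           (L≡ x (ℤ.≤-trans (ℤ.i≤i⊔j a b) h)) (ν≡ x (ℤ.≤-trans (ℤ.i≤j⊔i a b) h))

  opaque
    signature-at : Point → Signature size
    signature-at p = fromConj (f p) (f-antitone p) (proj₁ (f-full p)) (proj₁ (f-empty p))
                              (proj₂ (f-full p)) (proj₂ (f-empty p))

    conj-signature-at : ∀ p x → + conj (signature-at p) x ≡ L x p ℤ.+ + conj ν x
    conj-signature-at p x = trans (cong +_ (conj-fromConj (f p) (f-antitone p) (proj₁ (f-full p))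
        (proj₁ (f-empty p)) (proj₂ (f-full p)) (proj₂ (f-empty p)) x))
      (cong (λ z → z ℤ.+ + conj ν x) (+∣L∣ x p))

  signature-face : ∀ p → Face (signature-at p) (signature-at (p +e₁)) (signature-at (p +e₂))
                              (signature-at (p +e₁ +e₂))
  signature-face p = face (λ x → pulse (pulse-in x) p) λ x →
    plaq-≡ refl (sym (conj-signature-at p x)) (sym (conj-signature-at (p +e₁) x))
           (sym (conj-signature-at (p +e₂) x)) (sym (conj-signature-at (p +e₁ +e₂) x)) refl
           (plaq-shift (+ conj ν x) (column (passage-in x) p))

  signature-periodic : Periodic n signature-at
  signature-periodic k p = conj-injective λ x → ℤ.+-injective
    (trans (conj-signature-at (shift n k p) x)
    (trans (cong (λ z → z ℤ.+ + conj ν x) (Passage.periodic (passage-in x) k p))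
           (sym (conj-signature-at p x))))

  pulse-field : FominField n size
  pulse-field = field-from signature-at signature-periodic signature-face

  -- The carriers of `signature-face` are the pulses, the one at 0 being `C`, and every carrier of a
  -- face is its load.
  environment-pulse-field : ∀ p → environment pulse-field ⟨$⟩ p ≡ pulse C p
  environment-pulse-field p = sym (face-load (signature-face p)
    (face-κ⪯μ (signature-face p)) (face-κ⪯lam (signature-face p)) 0ℤ)

  past-pulse-field : ∀ x → Past (length-at pulse-field x) (+ conj ν x)
  past-pulse-field x = let s , pL = past (passage-in x) in s , λ p h →
    trans (conj-signature-at p x)
      (trans (cong (λ z → z ℤ.+ + conj ν x) (pL p h)) (ℤ.+-identityˡ _))

open PulseField using (pulse-field; environment-pulse-field; past-pulse-field)

-- Time is a function on the cylinder, so a finite set of faces is bounded in time.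
time-≈ : ∀ {n} p q → p ≈[ n ] q → time p ≡ time q
time-≈ {n} (x , y) _ (k , refl) = eq x y (k ℤ.* + n)
  where
  eq : ∀ x y z → x ℤ.+ y ≡ (x ℤ.+ z) ℤ.+ (y ℤ.- z)
  eq = solve-∀

time-bounds : ∀ {n} (ps : List Point) → ∃[ s ] ∃[ e ]
              ∀ p → Any (p ≈[ n ]_) ps → s ℤ.≤ time p × time p ℤ.≤ e
time-bounds []       = 0ℤ , 0ℤ , λ _ ()
time-bounds (q ∷ ps) with s , e , bounds ← time-bounds ps =
  time q ℤ.⊓ s , time q ℤ.⊔ e , λ where
    p (here p≈q) → ℤ.≤-trans (ℤ.i⊓j≤i (time q) s) (ℤ.≤-reflexive (sym (time-≈ p q p≈q))) ,
                   ℤ.≤-trans (ℤ.≤-reflexive (time-≈ p q p≈q)) (ℤ.i≤i⊔j (time q) e)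
    p (there p∈) → ℤ.≤-trans (ℤ.i⊓j≤j (time q) s) (proj₁ (bounds p p∈)) ,
                   ℤ.≤-trans (proj₂ (bounds p p∈)) (ℤ.i≤j⊔i (time q) e)

to-pulse : ∀ {n} (c : FaceMap n) → FinitelySupported {n} c → Pulse n
to-pulse {n} c (ps , supp) = record
  { pulse    = c ⟨$⟩_
  ; periodic = λ k p → sym (Func.cong c {p} {shift n k p} (k , refl))
  ; start    = ℤ.pred s
  ; before   = λ p h → vanishes p λ p∈ →
      suc≰ (subst (ℤ._≤ ℤ.pred s) (sym (ℤ.suc-pred s)) (ℤ.≤-trans (proj₁ (bounds p p∈)) h))
  ; stop     = ℤ.suc e
  ; after    = λ p h → vanishes p λ p∈ → suc≰ (ℤ.≤-trans h (proj₂ (bounds p p∈)))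
  }
  where
  s e : ℤ
  s = proj₁ (time-bounds {n} ps)
  e = proj₁ (proj₂ (time-bounds {n} ps))
  bounds : ∀ p → Any (p ≈[ n ]_) ps → s ℤ.≤ time p × time p ℤ.≤ e
  bounds = proj₂ (proj₂ (time-bounds {n} ps))
  vanishes : ∀ p → ¬ Any (p ≈[ n ]_) ps → c ⟨$⟩ p ≡ 0
  vanishes p p∉ with c ⟨$⟩ p ℕ.≟ 0
  ... | yes e = e
  ... | no ne = contradiction (supp p ne) p∉

-- Tableaux as chains, and the bijection

nth : ∀ {A : Set} {n} → Vec A (suc n) → ℕ → A
nth (x ∷ [])     i       = x
nth (x ∷ y ∷ xs) zero    = x
nth (x ∷ y ∷ xs) (suc i) = nth (y ∷ xs) i

nth-lookup : ∀ {A : Set} {n} (xs : Vec A (suc n)) i → nth xs (toℕ i) ≡ lookup xs i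
nth-lookup (x ∷ [])     zero    = refl
nth-lookup (x ∷ y ∷ xs) zero    = refl
nth-lookup (x ∷ y ∷ xs) (suc i) = nth-lookup (y ∷ xs) i

nth-head : ∀ {A : Set} {n} (xs : Vec A (suc n)) → nth xs 0 ≡ head xs
nth-head (x ∷ [])     = refl
nth-head (x ∷ y ∷ xs) = refl

nth-last : ∀ {A : Set} {n} (xs : Vec A (suc n)) → nth xs n ≡ last xs
nth-last (x ∷ [])     = refl
nth-last (x ∷ y ∷ xs) = nth-last (y ∷ xs)

-- Past its end the vector is continued by its last entry, so the links there are reflexive.
nth-⪯ : ∀ {ℓ n} (xs : Vec (Signature ℓ) (suc n)) →
        (∀ i → lookup xs (inject₁ i) ⪯ lookup xs (suc i)) → ∀ i → nth xs i ⪯ nth xs (suc i)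
nth-⪯ (x ∷ [])     h i       = ⪯-refl
nth-⪯ (x ∷ y ∷ xs) h zero    = subst (x ⪯_) (sym (nth-head (y ∷ xs))) (h zero)
nth-⪯ (x ∷ y ∷ xs) h (suc i) = nth-⪯ (y ∷ xs) (λ j → h (suc j)) i

-- The end conditions of a tableau are irrelevant equations; decidability lets them be recomputed.
_≟ₛ_ : ∀ {ℓ} (κ μ : Signature ℓ) → Dec (κ ≡ μ)
κ ≟ₛ μ = map′ signature-≡ (cong parts) (Vec.≡-dec ℤ._≟_ (parts κ) (parts μ))

module _ {ℓ n : ℕ} {outer inner : Signature ℓ} where

  tableau-chain : SST outer inner n → Chain ℓ
  tableau-chain (mkSST ch _ _ strips) = record
    { term = nth ch ; link = nth-⪯ ch (λ i → ⪯-recompute (strips i)) }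

  tableau-term : ∀ (P : SST outer inner n) i → term (tableau-chain P) (toℕ i) ≡ lookup (chain P) i
  tableau-term (mkSST ch _ _ _) = nth-lookup ch

  tableau-first : ∀ (P : SST outer inner n) → term (tableau-chain P) 0 ≡ inner
  tableau-first (mkSST ch first _ _) = trans (nth-head ch) (recompute (head ch ≟ₛ inner) first)

  tableau-final : ∀ (P : SST outer inner n) → term (tableau-chain P) n ≡ outer
  tableau-final (mkSST ch _ final _) = trans (nth-last ch) (recompute (last ch ≟ₛ outer) final)

module _ {n : ℕ} .{{_ : ℕ.NonZero n}} where

  pair-frame : (PQ : TableauPair n) → Frame n (TableauPair.len PQ)
  pair-frame (mkTableauPair outer inner P Q) = record
    { bot     = tableau-chain P
    ; left    = tableau-chain Q
    ; corner  = trans (tableau-first P) (sym (tableau-first Q))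
    ; closing = trans (tableau-final P) (sym (tableau-final Q))
    }

  opaque
    𝛌 : (PQ : TableauPair n) → FominField n (TableauPair.len PQ)
    𝛌 PQ = field-from (glue X) (glue-periodic X) (glue-face X)
      where
      X : Blocks n (TableauPair.len PQ)
      X = frame-blocks (pair-frame PQ)

    𝛌-boundary : ∀ PQ → HasBoundary PQ (𝛌 PQ)
    𝛌-boundary PQ@(mkTableauPair _ _ P Q) = record
      { on-axis₁ = λ i → trans
          (glue-block X (+ toℕ i) 0ℤ (toℕ i) 0 0ℤ 0ℤ (Fin.toℕ≤pred[n] i) z≤n
            (sym (ℤ.+-identityʳ (+ toℕ i))) refl)
          (tableau-term P i)
      ; on-axis₂ = λ i → trans
          (glue-block X 0ℤ (+ toℕ i) 0 (toℕ i) 0ℤ 0ℤ z≤n (Fin.toℕ≤pred[n] i) refl refl)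
          (trans (proj₂ (lines (pair-frame PQ) (toℕ i))) (tableau-term Q i))
      }
      where
      X : Blocks n (TableauPair.len PQ)
      X = frame-blocks (pair-frame PQ)

  boundary-unique : ∀ {PQ : TableauPair n} {Λ Λ′} → HasBoundary PQ Λ → HasBoundary PQ Λ′ →
                    ∀ p → at Λ p ≡ at Λ′ p
  boundary-unique {PQ} {Λ} {Λ′} B B′ = field-unique Λ Λ′
    (λ i i≤n → agree (λ k → at Λ (+ k , 0ℤ)) (λ k → at Λ′ (+ k , 0ℤ))
      (λ j → trans (HasBoundary.on-axis₁ B j) (sym (HasBoundary.on-axis₁ B′ j))) i i≤n)
    (λ i i≤n → agree (λ k → at Λ (0ℤ , + k)) (λ k → at Λ′ (0ℤ , + k))
      (λ j → trans (HasBoundary.on-axis₂ B j) (sym (HasBoundary.on-axis₂ B′ j))) i i≤n)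
    where
    agree : ∀ (g h : ℕ → Signature (TableauPair.len PQ)) →
            (∀ (j : Fin (suc n)) → g (toℕ j) ≡ h (toℕ j)) → ∀ i → i ≤ n → g i ≡ h i
    agree g h e i i≤n = subst (λ k → g k ≡ h k) (Fin.toℕ-fromℕ< (s≤s i≤n)) (e (fromℕ< (s≤s i≤n)))

  is-𝛌 : ∀ PQ → Is𝛌[P,Q] PQ (𝛌 PQ)
  is-𝛌 PQ = record
    { boundary = 𝛌-boundary PQ
    ; unique   = λ Λ′ B → boundary-unique {PQ} {Λ′} {𝛌 PQ} B (𝛌-boundary PQ)
    }

  -- The shapes `outer` and `inner` are the ends of the chain of P, so the chains determine the
  -- whole pair.
  pair-≡ : ∀ {ℓ} {outer outer′ inner inner′ : Signature ℓ} (P Q : SST outer inner n)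
           (P′ Q′ : SST outer′ inner′ n) → chain P ≡ chain P′ → chain Q ≡ chain Q′ →
           mkTableauPair outer inner P Q ≡ mkTableauPair outer′ inner′ P′ Q′
  pair-≡ {outer = outer} {outer′} {inner} {inner′} P Q P′ Q′ eP eQ = go P Q P′ Q′
    (trans (sym (tableau-final P)) (trans (nth-≡ P P′ eP n) (tableau-final P′)))
    (trans (sym (tableau-first P)) (trans (nth-≡ P P′ eP 0) (tableau-first P′))) eP eQ
    where
    nth-≡ : ∀ {ℓ} {o o′ ι ι′ : Signature ℓ} (P : SST o ι n) (P′ : SST o′ ι′ n) → chain P ≡ chain P′ →
            ∀ i → term (tableau-chain P) i ≡ term (tableau-chain P′) i
    nth-≡ (mkSST _ _ _ _) (mkSST _ _ _ _) refl i = refl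
    go : ∀ {ℓ} {o o′ ι ι′ : Signature ℓ} (P Q : SST o ι n) (P′ Q′ : SST o′ ι′ n) → o ≡ o′ → ι ≡ ι′ →
         chain P ≡ chain P′ → chain Q ≡ chain Q′ → mkTableauPair o ι P Q ≡ mkTableauPair o′ ι′ P′ Q′
    go (mkSST _ _ _ _) (mkSST _ _ _ _) (mkSST _ _ _ _) (mkSST _ _ _ _) refl refl refl refl = refl

  read-tableau : ∀ {ℓ} (g : ℕ → Signature ℓ) → (∀ i → g i ⪯ g (suc i)) → SST (g n) (g 0) n
  read-tableau g steps = mkSST (tabulate (λ i → g (toℕ i))) refl (last-tabulate n g)
    (λ i → subst₂ _⪯_
      (sym (trans (Vec.lookup∘tabulate (λ i → g (toℕ i)) (inject₁ i)) (cong g (Fin.toℕ-inject₁ i))))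
      (sym (Vec.lookup∘tabulate (λ i → g (toℕ i)) (suc i))) (steps (toℕ i)))
    where
    last-tabulate : ∀ n (g : ℕ → Signature _) → last (tabulate {n = suc n} (λ i → g (toℕ i))) ≡ g n
    last-tabulate zero    g = refl
    last-tabulate (suc n) g = last-tabulate n (λ i → g (suc i))

  -- The second tableau ends at (0 , n), which is the point (n , 0) of the cylinder. Its entries are
  -- transported together with it, so that they remain readable.
  read-pair : ∀ {ℓ} (Λ : FominField n ℓ) → Σ[ Q ∈ SST (at Λ (+ n , 0ℤ)) (at Λ (0ℤ , 0ℤ)) n ]
              (∀ i → lookup (chain Q) i ≡ at Λ (0ℤ , + toℕ i))
  read-pair Λ = subst (λ κ → Σ[ Q ∈ SST κ (at Λ (0ℤ , 0ℤ)) n ]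
                               (∀ i → lookup (chain Q) i ≡ at Λ (0ℤ , + toℕ i)))
    (trans (sym (field-periodic Λ 1ℤ (0ℤ , + n))) (cong (at Λ) (cong₂ _,_ (eq (+ n)) (eq′ (+ n)))))
    (read-tableau (λ i → at Λ (0ℤ , + i)) (λ i → FominField.interlace₂ Λ (0ℤ , + i)) ,
     Vec.lookup∘tabulate (λ i → at Λ (0ℤ , + toℕ i)))
    where
    eq : ∀ n → 0ℤ ℤ.+ 1ℤ ℤ.* n ≡ n
    eq = solve-∀
    eq′ : ∀ n → n ℤ.- 1ℤ ℤ.* n ≡ 0ℤ
    eq′ = solve-∀

  field-pair : ∀ {ℓ} → FominField n ℓ → TableauPair n
  field-pair Λ = mkTableauPair (at Λ (+ n , 0ℤ)) (at Λ (0ℤ , 0ℤ))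
    (read-tableau (λ i → at Λ (+ i , 0ℤ)) (λ i → FominField.interlace₁ Λ (+ i , 0ℤ)))
    (proj₁ (read-pair Λ))

  field-pair-boundary : ∀ {ℓ} (Λ : FominField n ℓ) → HasBoundary (field-pair Λ) Λ
  field-pair-boundary Λ = record
    { on-axis₁ = λ i → sym (Vec.lookup∘tabulate (λ i → at Λ (+ toℕ i , 0ℤ)) i)
    ; on-axis₂ = λ i → sym (proj₂ (read-pair Λ) i)
    }

  Ψ-injective : ∀ PQ PQ′ → (∀ p → environment (𝛌 PQ) ⟨$⟩ p ≡ environment (𝛌 PQ′) ⟨$⟩ p) →
                limit-signature (𝛌 PQ) ≡ limit-signature (𝛌 PQ′) → PQ ≡ PQ′
  Ψ-injective PQ PQ′ env lim =
    go PQ PQ′ (𝛌-boundary PQ) (𝛌-boundary PQ′) (field-determined (𝛌 PQ) (𝛌 PQ′) env lim)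
    where
    go : ∀ PQ PQ′ {Λ Λ′} → HasBoundary PQ Λ → HasBoundary PQ′ Λ′ →
         (∀ p → _≡_ {A = 𝕊} (TableauPair.len PQ , at Λ p) (TableauPair.len PQ′ , at Λ′ p)) → PQ ≡ PQ′
    go (mkTableauPair _ _ P Q) (mkTableauPair _ _ P′ Q′) B B′ same
      with refl ← cong proj₁ (same (0ℤ , 0ℤ)) = pair-≡ P Q P′ Q′
        (lookup-injective _ _ λ i → trans (sym (HasBoundary.on-axis₁ B i))
          (trans (unpack (same _)) (HasBoundary.on-axis₁ B′ i)))
        (lookup-injective _ _ λ i → trans (sym (HasBoundary.on-axis₂ B i))
          (trans (unpack (same _)) (HasBoundary.on-axis₂ B′ i)))
      where
      unpack : ∀ {ℓ} {κ μ : Signature ℓ} → _≡_ {A = 𝕊} (ℓ , κ) (ℓ , μ) → κ ≡ μ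
      unpack refl = refl

  -- The field built from the pulse has the boundary read off from it, so by uniqueness it is `𝛌` of
  -- that boundary pointwise.
  Ψ-surjective : ∀ (C : Pulse n) (ν : 𝕊) → Σ[ PQ ∈ TableauPair n ]
                 (∀ p → environment (𝛌 PQ) ⟨$⟩ p ≡ pulse C p) × limit-signature (𝛌 PQ) ≡ ν
  Ψ-surjective C ν = PQ ,
    (λ p → trans (load-≡ (same p) (same (p +e₁)) (same (p +e₂))) (environment-pulse-field C ν p)) ,
    limit-signature-unique (𝛌 PQ) ν (λ x → let s , pL = past-pulse-field C ν x in
      s , λ p h → trans (cong (λ κ → + conj κ x) (same p)) (pL p h))
    where
    Λ : FominField n _
    Λ = pulse-field C ν
    PQ : TableauPair n
    PQ = field-pair Λ
    same : ∀ p → at (𝛌 PQ) p ≡ at Λ p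
    same = boundary-unique {PQ} {𝛌 PQ} {Λ} (𝛌-boundary PQ) (field-pair-boundary Λ)
    load-≡ : ∀ {ℓ} {κ κ′ μ μ′ lam lam′ : Signature ℓ} → κ ≡ κ′ → μ ≡ μ′ → lam ≡ lam′ →
             load κ μ lam 0ℤ ≡ load κ′ μ′ lam′ 0ℤ
    load-≡ refl refl refl = refl

proposition1p10 : ∀ (n : ℕ) → 1 ≤ n →
    Σ[ Ψ ∈ Bijection (Source n) (Target n) ]
      (∀ (PQ : TableauPair n) → IsΨ PQ (Bijection.to Ψ PQ))
proposition1p10 n 1≤n = bijection , λ PQ → record
    { 𝛌     = 𝛌 PQ
    ; is-𝛌  = is-𝛌 PQ
    ; env   = λ p → refl
    ; limit = limit-isLimit (𝛌 PQ)
    }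
  where
  instance
    nonZero : ℕ.NonZero n
    nonZero = ℕ.>-nonZero 1≤n
  bijection : Bijection (Source n) (Target n)
  bijection = record
    { to        = λ PQ → (environment (𝛌 PQ) , environment-finite (𝛌 PQ)) , limit-signature (𝛌 PQ)
    ; cong      = λ { refl → (λ p → refl) , refl }
    ; bijective = (λ {PQ} {PQ′} (env , lim) → Ψ-injective PQ PQ′ env lim) ,
        λ ((c , fin) , ν) → let PQ , env , lim = Ψ-surjective (to-pulse c fin) ν
                            in PQ , λ { refl → env , lim }
    }
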